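{- For every integer $n\geq 1$, the middle layer graph $Q_{2n+1}(n,n+1)$ has at least $\frac{1}{4}\,2^{2^{\lfloor (n+1)/4\rfloor}}$ different Hamilton cycles.
   Context: For $m\geq 1$ and $0\leq k\leq m$, let $B_m(k)$ denote the set of bitstrings of length $m$ with exactly $k$ entries equal to $1$. The middle layer graph $Q_{2n+1}(n,n+1)$ is the graph with vertex set $B_{2n+1}(n)\cup B_{2n+1}(n+1)$, in which two vertices are adjacent if and only if the corresponding bitstrings differ in exactly one bit. Two Hamilton cycles are different if they are different subgraphs (different edge sets). -}

module Defs where

open import Data.Bool using (Bool; true; false; _xor_)
open import Data.Nat using (ℕ; zero; suc; _+_; _*_; _≤_)
open import Data.Vec using (Vec; []; _∷_; zipWith)
open import Data.List using (List; []; _∷_; _++_; [_]; zip; length)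
open import Data.List.Membership.Propositional using (_∈_)
open import Data.List.Relation.Unary.All using (All)
open import Data.List.Relation.Unary.Unique.Propositional using (Unique)
open import Data.Product using (_×_; _,_; proj₁; proj₂)
open import Data.Sum using (_⊎_)
open import Function.Bundles using (_⇔_)
open import Relation.Nullary using (¬_)
open import Relation.Binary.PropositionalEquality using (_≡_)

weight : ∀ {m} → Vec Bool m → ℕ
weight []          = 0
weight (true ∷ v)  = suc (weight v)
weight (false ∷ v) = weight v

hamming : ∀ {m} → Vec Bool m → Vec Bool m → ℕ
hamming u v = weight (zipWith _xor_ u v)

BitStr : ℕ → Set
BitStr n = Vec Bool (2 * n + 1)

IsMiddleVertex : (n : ℕ) → BitStr n → Set
IsMiddleVertex n v = weight v ≡ n ⊎ weight v ≡ suc n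

Adjacent : ∀ {m} → Vec Bool m → Vec Bool m → Set
Adjacent u v = hamming u v ≡ 1

cyclicPairs : {A : Set} → List A → List (A × A)
cyclicPairs []       = []
cyclicPairs (x ∷ xs) = zip (x ∷ xs) (xs ++ [ x ])

record IsHamiltonCycle (n : ℕ) (c : List (BitStr n)) : Set where
  field
    long      : 3 ≤ length c
    distinct  : Unique c
    inGraph   : All (IsMiddleVertex n) c
    spanning  : ∀ v → IsMiddleVertex n v → v ∈ c
    adjacent  : All (λ p → Adjacent (proj₁ p) (proj₂ p)) (cyclicPairs c)

EdgeOf : ∀ {m} → List (Vec Bool m) → Vec Bool m → Vec Bool m → Set
EdgeOf c u v = (u , v) ∈ cyclicPairs c ⊎ (v , u) ∈ cyclicPairs c

-- two cycles are different iff they are different subgraphs (different edge sets)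
DifferentCycles : ∀ {m} → List (Vec Bool m) → List (Vec Bool m) → Set
DifferentCycles c d = ¬ (∀ u v → EdgeOf c u v ⇔ EdgeOf d u v)

{-# OPTIONS --safe #-}

-- The middle vertices are the N = 2n + 1 rotations of the words false ∷ w and true ∷ w, where w is
-- the bracket word of a forest with n edges (cycle lemma). Joining false ∷ w to true ∷ w, and to
-- the rotated true ∷ w′, where w′ belongs to the forest with its root moved along one edge, gives
-- a 2-factor. As 2n moves of the root restore a forest and N is coprime to 2n, the cycles of this
-- 2-factor correspond to the plane trees with n edges.
-- Pulling a leaf towards the root relates two plane trees whose cycles are met by a hexagon, in
-- each of N rotations. Switching along it replaces one edge of the cycle of the tree after the
-- pull by a detour through all vertices of the cycle of the tree before the pull. A pull lowers
-- the sum of all depths, so all cycles can be attached in turn to that of the star, and the edges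
-- required by different hexagons never coincide. Two of the rotations are allowed for every
-- attached tree, and these choices can be read off the edges of the Hamilton cycle. Each plane tree
-- comes from at most 2n of the at least 2 ^ (n - 1) forests, which bounds their number.
module Submission where

open import Defs
open import Data.Bool using (Bool; true; false; not)
import Data.Bool.Properties as Bool
open import Data.Empty using (⊥; ⊥-elim)
open import Data.List using (List; []; _∷_; _++_; [_]; length; map; reverse; zip; take; drop; upTo; cartesianProductWith)
open import Data.List.Membership.Propositional using (_∈_; _∉_)
open import Data.List.Membership.Propositional.Properties
  using (∈-∃++; ∈-++⁺ˡ; ∈-++⁺ʳ; ∈-++⁻; ∈-map⁺; ∈-map⁻; ∈-upTo⁺; ∈-upTo⁻; ∈-cartesianProductWith⁺)
open import Data.List.Properties
  using (++-assoc; ++-identityʳ; length-++; length-map; length-take; length-upTo; ∷-injectiveˡ; ∷-injectiveʳ; ∷ʳ-injective;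
         reverse-++; take++drop≡id; unfold-reverse)
open import Data.List.Relation.Binary.Permutation.Propositional
  using (_↭_; prep; ↭-sym; ↭-trans; ↭⇒↭ₛ)
open import Data.List.Relation.Binary.Permutation.Propositional.Properties
  using (∈-resp-↭; shift; ↭-reverse; ++⁺ʳ; ↭-length; ++-comm)
import Data.List.Relation.Binary.Permutation.Setoid.Properties as SetoidPerm
open import Data.List.Relation.Unary.All as All using (All; []; _∷_)
import Data.List.Relation.Unary.All.Properties as All
open import Data.List.Relation.Unary.AllPairs as AllPairs using (AllPairs; []; _∷_)
import Data.List.Relation.Unary.AllPairs.Properties as AllPairs
open import Data.List.Relation.Unary.Any using (here; there)
open import Data.List.Relation.Unary.Unique.Propositional using (Unique)
import Data.List.Relation.Unary.Unique.Propositional.Properties as Unique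
open import Data.Nat using (ℕ; zero; suc; _+_; _*_; _∸_; _^_; _/_; _%_; _≤_; _<_; z≤n; s≤s; s≤s⁻¹)
open import Data.Nat.DivMod using (m≡m%n+[m/n]*n; m%n<n)
open import Data.Nat.Divisibility using (_∣_; divides; ∣m+n∣m⇒∣n; ∣⇒≤)
open import Data.Nat.Properties
open import Data.Nat.Tactic.RingSolver using (solve-∀)
open import Data.Product using (Σ; ∃; ∃₂; _×_; _,_; proj₁; proj₂)
open import Data.Sum using (_⊎_; inj₁; inj₂)
open import Data.Unit using (⊤; tt)
open import Data.Vec using (Vec; []; _∷_; toList)
import Data.Vec.Properties as Vec
open import Function.Bundles using (Equivalence)
open import Relation.Binary.PropositionalEquality hiding ([_])
open import Relation.Nullary using (¬_; yes; no; Dec)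
open import Relation.Nullary.Decidable using (from-yes; from-no; map′)

-- Switching along a hexagon need not join two cycles into one: it takes two edges from the cycle of
-- `before u v`, which cuts that cycle into two paths. The construction succeeds because both edges
-- occur within the first three moves of the root on the same traversal, so the short path between
-- them can be run backwards and the two paths line up as one detour. The edge of the other cycle
-- that gives way joins `after u v` to its image under `σ`. As `after u v` determines `before u v`,
-- and each plane tree is attached only once, no such edge is asked for twice. Of the two edges lost
-- on the attached cycle, one leaves `before u v` and the other joins the two vertices of one
-- forest; neither has the form that a later hexagon needs. This is why any order works in which
-- each pull ends in a tree already attached, and why the edges at a lower vertex of `before u v`
-- that record a choice are never destroyed later.

-- Plane forests and the moves of the root

infixr 6 _⊕_

-- node u v is the plane forest whose first tree has child forest u, followed by v
data Tree : Set where
  leaf : Tree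
  node : Tree → Tree → Tree

_⊕_ : Tree → Tree → Tree
leaf     ⊕ t = t
node u v ⊕ t = node u (v ⊕ t)

⊕-assoc : ∀ s t u → (s ⊕ t) ⊕ u ≡ s ⊕ (t ⊕ u)
⊕-assoc leaf       t u = refl
⊕-assoc (node a b) t u = cong (node a) (⊕-assoc b t u)

⊕-leaf : ∀ t → t ⊕ leaf ≡ t
⊕-leaf leaf       = refl
⊕-leaf (node a b) = cong (node a) (⊕-leaf b)

size : Tree → ℕ
size leaf       = 0
size (node u v) = suc (size u + size v)

size-⊕ : ∀ s t → size (s ⊕ t) ≡ size s + size t
size-⊕ leaf       t = refl
size-⊕ (node a b) t =
  cong suc (trans (cong (size a +_) (size-⊕ b t)) (sym (+-assoc (size a) _ _)))

node-injective : ∀ {a b c d} → node a b ≡ node c d → a ≡ c × b ≡ d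
node-injective refl = refl , refl

infix 4 _≟ᵀ_

_≟ᵀ_ : (s t : Tree) → Dec (s ≡ t)
leaf     ≟ᵀ leaf     = yes refl
leaf     ≟ᵀ node _ _ = no λ ()
node _ _ ≟ᵀ leaf     = no λ ()
node a b ≟ᵀ node c d with a ≟ᵀ c | b ≟ᵀ d
... | yes refl | yes refl = yes refl
... | no a≢c   | _        = no λ { refl → a≢c refl }
... | yes _    | no b≢d   = no λ { refl → b≢d refl }

-- moves the root of the plane tree along its first edge
σ : Tree → Tree
σ leaf       = leaf
σ (node u v) = u ⊕ node v leaf

σ^ : ℕ → Tree → Tree
σ^ zero    t = t
σ^ (suc i) t = σ (σ^ i t)

σ^-+ : ∀ i j t → σ^ (i + j) t ≡ σ^ i (σ^ j t)
σ^-+ zero    j t = refl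
σ^-+ (suc i) j t = cong σ (σ^-+ i j t)

size-σ : ∀ t → size (σ t) ≡ size t
size-σ leaf       = refl
size-σ (node u v) = trans (size-⊕ u (node v leaf))
  (trans (+-suc (size u) _) (cong (λ k → suc (size u + k)) (+-identityʳ (size v))))

size-σ^ : ∀ i t → size (σ^ i t) ≡ size t
size-σ^ zero    t = refl
size-σ^ (suc i) t = trans (size-σ (σ^ i t)) (size-σ^ i t)

-- The root walks around the trees of `s`, passing each edge once in each direction, and leaves
-- every finished tree behind those of `t`.
σ^-swap : ∀ s t → σ^ (size s + size s) (s ⊕ t) ≡ t ⊕ s
σ^-swap leaf       t = sym (⊕-leaf t)
σ^-swap (node a b) t = begin
  σ^ (size (node a b) + size (node a b)) (node a (b ⊕ t))
    ≡⟨ cong (λ k → σ^ k (node a (b ⊕ t))) (count (size a) (size b)) ⟩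
  σ^ ((size b + size b) + (1 + ((size a + size a) + 1))) (node a (b ⊕ t))
    ≡⟨ σ^-+ (size b + size b) _ _ ⟩
  σ^ (size b + size b) (σ (σ^ ((size a + size a) + 1) (node a (b ⊕ t))))
    ≡⟨ cong (λ s → σ^ (size b + size b) (σ s)) (σ^-+ (size a + size a) 1 _) ⟩
  σ^ (size b + size b) (σ (σ^ (size a + size a) (a ⊕ node (b ⊕ t) leaf)))
    ≡⟨ cong (λ s → σ^ (size b + size b) (σ s)) (σ^-swap a _) ⟩
  σ^ (size b + size b) ((b ⊕ t) ⊕ node a leaf)
    ≡⟨ cong (σ^ (size b + size b)) (⊕-assoc b t _) ⟩
  σ^ (size b + size b) (b ⊕ (t ⊕ node a leaf))
    ≡⟨ σ^-swap b _ ⟩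
  (t ⊕ node a leaf) ⊕ b
    ≡⟨ ⊕-assoc t _ b ⟩
  t ⊕ node a b ∎
  where
  open ≡-Reasoning
  count : ∀ x y → suc (x + y) + suc (x + y) ≡ (y + y) + (1 + ((x + x) + 1))
  count = solve-∀

σ^-period : ∀ t → σ^ (size t + size t) t ≡ t
σ^-period t = trans (cong (σ^ (size t + size t)) (sym (⊕-leaf t))) (σ^-swap t leaf)

σ-cycle : ∀ t k → σ^ (k * (size t + size t)) t ≡ t
σ-cycle t zero    = refl
σ-cycle t (suc k) = trans (σ^-+ (size t + size t) _ t)
  (trans (cong (σ^ (size t + size t)) (σ-cycle t k)) (σ^-period t))

-- `σ` has finite order, so one of its powers undoes it. For `leaf` the exponent is truncated to 0,
-- which is right because `σ` fixes `leaf`.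
σ-inverse : ∀ t → σ^ (size t + size t ∸ 1) (σ t) ≡ t
σ-inverse leaf         = refl
σ-inverse t@(node u v) = trans (sym (σ^-+ k 1 t))
  (trans (cong (λ k → σ^ k t) (+-comm k 1)) (σ^-period t))
  where k = size u + size v + size t

σ-injective : ∀ {s t} → σ s ≡ σ t → s ≡ t
σ-injective {s} {t} e = trans (sym (σ-inverse s))
  (trans (cong₂ (λ k r → σ^ (k + k ∸ 1) r) (trans (sym (size-σ s)) (trans (cong size e) (size-σ t))) e)
         (σ-inverse t))

σ^-return : ∀ i t → ∃ λ m → σ^ m (σ^ i t) ≡ t
σ^-return zero    t = 0 , refl
σ^-return (suc i) t with σ^-return i t
... | m , e = m + p , trans (σ^-+ m p _) (trans (cong (σ^ m) (σ-inverse (σ^ i t))) e)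
  where p = size (σ^ i t) + size (σ^ i t) ∸ 1

-- Bracket words

-- A bitstring is an opening bracket for false and a closing one for true; the trees of the
-- forest are written from right to left, so that σ corresponds to a left rotation.
W : Tree → List Bool
W leaf       = []
W (node u v) = W v ++ false ∷ W u ++ [ true ]

W-⊕ : ∀ s t → W (s ⊕ t) ≡ W t ++ W s
W-⊕ leaf       t = sym (++-identityʳ (W t))
W-⊕ (node a b) t =
  trans (cong (_++ false ∷ W a ++ [ true ]) (W-⊕ b t)) (++-assoc (W t) (W b) _)

W-node-++ : ∀ u v w → W (node u v) ++ w ≡ W v ++ false ∷ W u ++ true ∷ w
W-node-++ u v w = trans (++-assoc (W v) _ w)
  (cong (λ z → W v ++ false ∷ z) (++-assoc (W u) [ true ] w))

ones zeros : List Bool → ℕ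
ones []           = 0
ones (true ∷ w)   = suc (ones w)
ones (false ∷ w)  = ones w
zeros []          = 0
zeros (true ∷ w)  = zeros w
zeros (false ∷ w) = suc (zeros w)

ones-++ : ∀ a b → ones (a ++ b) ≡ ones a + ones b
ones-++ []          b = refl
ones-++ (true ∷ a)  b = cong suc (ones-++ a b)
ones-++ (false ∷ a) b = ones-++ a b

zeros-++ : ∀ a b → zeros (a ++ b) ≡ zeros a + zeros b
zeros-++ []          b = refl
zeros-++ (true ∷ a)  b = zeros-++ a b
zeros-++ (false ∷ a) b = cong suc (zeros-++ a b)

length≡ones+zeros : ∀ w → length w ≡ ones w + zeros w
length≡ones+zeros []          = refl
length≡ones+zeros (true ∷ w)  = cong suc (length≡ones+zeros w)
length≡ones+zeros (false ∷ w) = trans (cong suc (length≡ones+zeros w)) (sym (+-suc (ones w) _))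

ones-W : ∀ t → ones (W t) ≡ size t
ones-W leaf       = refl
ones-W (node u v) = begin
  ones (W v ++ false ∷ W u ++ [ true ])  ≡⟨ ones-++ (W v) _ ⟩
  ones (W v) + ones (W u ++ [ true ])    ≡⟨ cong (ones (W v) +_) (ones-++ (W u) _) ⟩
  ones (W v) + (ones (W u) + 1)          ≡⟨ cong₂ (λ x y → x + (y + 1)) (ones-W v) (ones-W u) ⟩
  size v + (size u + 1)                  ≡⟨ shuffle (size v) (size u) ⟩
  suc (size u + size v)                  ∎
  where
  open ≡-Reasoning
  shuffle : ∀ x y → x + (y + 1) ≡ suc (y + x)
  shuffle = solve-∀

zeros-W : ∀ t → zeros (W t) ≡ size t
zeros-W leaf       = refl
zeros-W (node u v) = begin
  zeros (W v ++ false ∷ W u ++ [ true ])     ≡⟨ zeros-++ (W v) _ ⟩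
  zeros (W v) + suc (zeros (W u ++ [ true ])) ≡⟨ cong (λ k → zeros (W v) + suc k) (zeros-++ (W u) _) ⟩
  zeros (W v) + suc (zeros (W u) + 0)        ≡⟨ cong₂ (λ x y → x + suc (y + 0)) (zeros-W v) (zeros-W u) ⟩
  size v + suc (size u + 0)                  ≡⟨ shuffle (size v) (size u) ⟩
  suc (size u + size v)                      ∎
  where
  open ≡-Reasoning
  shuffle : ∀ x y → x + suc (y + 0) ≡ suc (y + x)
  shuffle = solve-∀

length-W : ∀ t → length (W t) ≡ 2 * size t
length-W t = trans (length≡ones+zeros (W t))
  (cong₂ _+_ (ones-W t) (trans (zeros-W t) (sym (+-identityʳ (size t)))))

Ballot : ℕ → List Bool → Set
Ballot h       []          = ⊤
Ballot h       (false ∷ w) = Ballot (suc h) w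
Ballot zero    (true ∷ w)  = ⊥
Ballot (suc h) (true ∷ w)  = Ballot h w

ballot-W-++ : ∀ t h w → Ballot h w → Ballot h (W t ++ w)
ballot-W-++ leaf       h w b = b
ballot-W-++ (node u v) h w b = subst (Ballot h) (sym (W-node-++ u v w))
  (ballot-W-++ v h _ (ballot-W-++ u (suc h) (true ∷ w) b))

ballot-prefix : ∀ a c h → Ballot h (a ++ c) → ones a ≤ h + zeros a
ballot-prefix []          c h       b = z≤n
ballot-prefix (false ∷ a) c h       b = subst (ones a ≤_) (sym (+-suc h _)) (ballot-prefix a c (suc h) b)
ballot-prefix (true ∷ a)  c (suc h) b = s≤s (ballot-prefix a c h b)

W-prefix : ∀ t a c → W t ≡ a ++ c → ones a ≤ zeros a
W-prefix t a c e = ballot-prefix a c 0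
  (subst (Ballot 0) (trans (++-identityʳ (W t)) e) (ballot-W-++ t 0 [] tt))

W-balanced : ∀ t w → W t ≡ w → ones w ≡ zeros w
W-balanced t w e = trans (cong ones (sym e)) (trans (trans (ones-W t) (sym (zeros-W t))) (cong zeros e))

-- Both words would have to be balanced although their excesses of false over true have the
-- wrong sum.
no-proper-rotation : ∀ b a c s t → W s ≡ c ++ b ∷ a → W t ≡ a ++ b ∷ c → ⊥
no-proper-rotation false a c s t es et = <-irrefl total (begin-strict
  ones c + ones a          <⟨ s≤s (+-mono-≤ (W-prefix s c _ es) (W-prefix t a _ et)) ⟩
  suc (zeros c + zeros a)  ≡⟨ sym (+-suc (zeros c) _) ⟩
  zeros c + suc (zeros a)  ∎)
  where
  open ≤-Reasoning
  total : ones c + ones a ≡ zeros c + suc (zeros a)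
  total = trans (sym (ones-++ c _)) (trans (W-balanced s _ es) (zeros-++ c _))
no-proper-rotation true a c s t es et = <-irrefl total (begin-strict
  ones c + suc (ones a)        <⟨ ≤-refl ⟩
  suc (ones c) + suc (ones a)  ≤⟨ +-mono-≤ (excess s c a es) (excess t a c et) ⟩
  zeros c + zeros a            ∎)
  where
  open ≤-Reasoning
  total : ones c + suc (ones a) ≡ zeros c + zeros a
  total = trans (sym (ones-++ c _)) (trans (W-balanced s _ es) (zeros-++ c _))
  excess : ∀ s c a → W s ≡ c ++ true ∷ a → suc (ones c) ≤ zeros c
  excess s c a e = subst₂ _≤_ (trans (ones-++ c _) (+-comm (ones c) 1))
    (trans (zeros-++ c _) (+-identityʳ (zeros c)))
    (W-prefix s (c ++ [ true ]) a (trans e (sym (++-assoc c [ true ] a))))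

-- Rotations of words

rotl : List Bool → List Bool
rotl []      = []
rotl (x ∷ w) = w ++ [ x ]

rots : ℕ → List Bool → List Bool
rots zero    w = w
rots (suc j) w = rots j (rotl w)

rots-+ : ∀ i j w → rots (i + j) w ≡ rots j (rots i w)
rots-+ zero    j w = refl
rots-+ (suc i) j w = rots-+ i j (rotl w)

rots-length-++ : ∀ a b → rots (length a) (a ++ b) ≡ b ++ a
rots-length-++ []      b = sym (++-identityʳ b)
rots-length-++ (x ∷ a) b = begin
  rots (length a) ((a ++ b) ++ [ x ])  ≡⟨ cong (rots (length a)) (++-assoc a b [ x ]) ⟩
  rots (length a) (a ++ b ++ [ x ])    ≡⟨ rots-length-++ a (b ++ [ x ]) ⟩
  (b ++ [ x ]) ++ a                    ≡⟨ ++-assoc b [ x ] a ⟩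
  b ++ x ∷ a                           ∎
  where open ≡-Reasoning

rots-length : ∀ w → rots (length w) w ≡ w
rots-length w = trans (cong (rots (length w)) (sym (++-identityʳ w))) (rots-length-++ w [])

length-rotl : ∀ w → length (rotl w) ≡ length w
length-rotl []      = refl
length-rotl (x ∷ w) = trans (length-++ w) (+-comm (length w) 1)

length-rots : ∀ j w → length (rots j w) ≡ length w
length-rots zero    w = refl
length-rots (suc j) w = trans (length-rots j (rotl w)) (length-rotl w)

ones-rotl : ∀ w → ones (rotl w) ≡ ones w
ones-rotl []          = refl
ones-rotl (true ∷ w)  = trans (ones-++ w _) (+-comm (ones w) 1)
ones-rotl (false ∷ w) = trans (ones-++ w _) (+-identityʳ (ones w))

ones-rots : ∀ j w → ones (rots j w) ≡ ones w
ones-rots zero    w = refl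
ones-rots (suc j) w = trans (ones-rots j (rotl w)) (ones-rotl w)

rotl-injective : ∀ v w → rotl v ≡ rotl w → v ≡ w
rotl-injective []          []          e = refl
rotl-injective []          (_ ∷ [])    ()
rotl-injective []          (_ ∷ _ ∷ _) ()
rotl-injective (_ ∷ [])    []          ()
rotl-injective (_ ∷ _ ∷ _) []          ()
rotl-injective (x ∷ v)     (y ∷ w)     e = let v≡w , x≡y = ∷ʳ-injective v w e in cong₂ _∷_ x≡y v≡w

rots-injective : ∀ j v w → rots j v ≡ rots j w → v ≡ w
rots-injective zero    v w e = e
rots-injective (suc j) v w e = rotl-injective v w (rots-injective j (rotl v) (rotl w) e)

-- Bracket matching and the cycle lemma

closers openers : List Tree → List Bool
closers []       = []
closers (t ∷ ts) = true ∷ W t ++ closers ts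
openers []       = []
openers (t ∷ ts) = false ∷ W t ++ openers ts

-- (t , ts , es) stands for the word W t ++ closers ts ++ openers es; every bitstring has
-- this form in exactly one way.
Parse : Set
Parse = Tree × List Tree × List Tree

unparse : Parse → List Bool
unparse (t , ts , es) = W t ++ closers ts ++ openers es

-- A new opening bracket is matched with the first unmatched closing bracket, if there is one. The
-- pair forms the last tree of the forest, because forests are written from right to left.
prepend : Bool → Parse → Parse
prepend true  (t , ts     , es) = leaf , t ∷ ts , es
prepend false (t , []     , es) = leaf , [] , t ∷ es
prepend false (t , x ∷ ts , es) = x ⊕ node t leaf , ts , es

parse : List Bool → Parse
parse []      = leaf , [] , []
parse (b ∷ w) = prepend b (parse w)

unparse-prepend : ∀ b p → unparse (prepend b p) ≡ b ∷ unparse p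
unparse-prepend true  (t , ts     , es) = cong (true ∷_) (++-assoc (W t) (closers ts) (openers es))
unparse-prepend false (t , []     , es) = refl
unparse-prepend false (t , x ∷ ts , es) = begin
  W (x ⊕ node t leaf) ++ rest              ≡⟨ cong (_++ rest) (W-⊕ x (node t leaf)) ⟩
  (W (node t leaf) ++ W x) ++ rest         ≡⟨ ++-assoc (W (node t leaf)) (W x) rest ⟩
  W (node t leaf) ++ W x ++ rest           ≡⟨ W-node-++ t leaf _ ⟩
  false ∷ W t ++ true ∷ W x ++ rest        ≡⟨ cong (λ z → false ∷ W t ++ true ∷ z) (sym (++-assoc (W x) (closers ts) _)) ⟩
  false ∷ W t ++ true ∷ (W x ++ closers ts) ++ openers es ∎
  where
  open ≡-Reasoning
  rest = closers ts ++ openers es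

unparse-parse : ∀ w → unparse (parse w) ≡ w
unparse-parse []      = refl
unparse-parse (b ∷ w) = trans (unparse-prepend b (parse w)) (cong (b ∷_) (unparse-parse w))

-- The rest `w` is arbitrary because the induction meets `W u` in front of its still unmatched
-- closing bracket.
parse-W-++ : ∀ s w → parse (W s ++ w) ≡ (proj₁ (parse w) ⊕ s , proj₂ (parse w))
parse-W-++ leaf       w = cong (_, proj₂ (parse w)) (sym (⊕-leaf (proj₁ (parse w))))
parse-W-++ (node u v) w = begin
  parse (W (node u v) ++ w)                 ≡⟨ cong parse (W-node-++ u v w) ⟩
  parse (W v ++ false ∷ W u ++ true ∷ w)    ≡⟨ parse-W-++ v _ ⟩
  (proj₁ q ⊕ v , proj₂ q)                   ≡⟨ cong (λ p → proj₁ p ⊕ v , proj₂ p) (cong (prepend false) (parse-W-++ u _)) ⟩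
  ((t ⊕ node u leaf) ⊕ v , proj₂ (parse w)) ≡⟨ cong (_, proj₂ (parse w)) (⊕-assoc t (node u leaf) v) ⟩
  (t ⊕ node u v , proj₂ (parse w))          ∎
  where
  open ≡-Reasoning
  t = proj₁ (parse w)
  q = parse (false ∷ W u ++ true ∷ w)

W-injective : ∀ {s t} → W s ≡ W t → s ≡ t
W-injective {s} {t} e = begin
  s                    ≡⟨ sym (recover s) ⟩
  proj₁ (parse (W s))  ≡⟨ cong (λ w → proj₁ (parse w)) e ⟩
  proj₁ (parse (W t))  ≡⟨ recover t ⟩
  t                    ∎
  where
  open ≡-Reasoning
  recover : ∀ s → proj₁ (parse (W s)) ≡ s
  recover s = trans (cong (λ w → proj₁ (parse w)) (sym (++-identityʳ (W s))))
                    (cong proj₁ (parse-W-++ s []))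

-- A suitable rotation puts the unmatched opening brackets in front of the unmatched closing ones.
-- They then match from the inside outwards, and only the surplus of `r` closing brackets survives.
match-brackets : ∀ e es t ts r → length ts ≡ length es + r →
  ∃₂ λ s rest → W e ++ openers es ++ W t ++ closers ts ≡ W s ++ closers rest × length rest ≡ r
match-brackets e []        t ts r l = t ⊕ e , ts ,
  trans (sym (++-assoc (W e) (W t) _)) (cong (_++ closers ts) (sym (W-⊕ t e))) , l
match-brackets e (e′ ∷ es) t ts r l with match-brackets e′ es t ts (suc r) (trans l (sym (+-suc _ r)))
... | s , x ∷ rest , eq , l′ = x ⊕ node s e , rest , (begin
  W e ++ false ∷ ((W e′ ++ openers es) ++ W t ++ closers ts)
    ≡⟨ cong (λ z → W e ++ false ∷ z) (trans (++-assoc (W e′) (openers es) _) eq) ⟩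
  W e ++ false ∷ W s ++ true ∷ W x ++ closers rest
    ≡⟨ sym (W-node-++ s e _) ⟩
  W (node s e) ++ W x ++ closers rest
    ≡⟨ sym (++-assoc (W (node s e)) (W x) _) ⟩
  (W (node s e) ++ W x) ++ closers rest
    ≡⟨ cong (_++ closers rest) (sym (W-⊕ x (node s e))) ⟩
  W (x ⊕ node s e) ++ closers rest ∎) , suc-injective l′
  where open ≡-Reasoning

-- Matched brackets cancel, so ones and zeros differ only by the unmatched ones.
count-parse : ∀ t ts es → ones (unparse (t , ts , es)) + length es ≡ zeros (unparse (t , ts , es)) + length ts
count-parse t ts es = begin
  ones (W t ++ closers ts ++ openers es) + length es
    ≡⟨ cong (_+ length es) (trans (ones-++ (W t) _) (cong₂ _+_ (ones-W t) (ones-++ (closers ts) _))) ⟩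
  (size t + (ones (closers ts) + ones (openers es))) + length es
    ≡⟨ shuffle (size t) _ _ (bracket-closers ts) (bracket-openers es) ⟩
  (size t + (zeros (closers ts) + zeros (openers es))) + length ts
    ≡⟨ cong (_+ length ts) (sym (trans (zeros-++ (W t) _) (cong₂ _+_ (zeros-W t) (zeros-++ (closers ts) _)))) ⟩
  zeros (W t ++ closers ts ++ openers es) + length ts ∎
  where
  open ≡-Reasoning
  bracket-closers : ∀ ts → ones (closers ts) ≡ zeros (closers ts) + length ts
  bracket-closers []       = refl
  bracket-closers (t ∷ ts) = begin
    suc (ones (W t ++ closers ts))           ≡⟨ cong suc (ones-++ (W t) _) ⟩
    suc (ones (W t) + ones (closers ts))     ≡⟨ cong suc (cong₂ _+_ (trans (ones-W t) (sym (zeros-W t))) (bracket-closers ts)) ⟩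
    suc (zeros (W t) + (zeros (closers ts) + length ts)) ≡⟨ cong suc (sym (+-assoc (zeros (W t)) _ _)) ⟩
    suc (zeros (W t) + zeros (closers ts) + length ts)   ≡⟨ cong (λ k → suc (k + length ts)) (sym (zeros-++ (W t) _)) ⟩
    suc (zeros (W t ++ closers ts) + length ts)          ≡⟨ sym (+-suc _ _) ⟩
    zeros (W t ++ closers ts) + suc (length ts)          ∎
  bracket-openers : ∀ es → ones (openers es) + length es ≡ zeros (openers es)
  bracket-openers []       = refl
  bracket-openers (t ∷ ts) = begin
    ones (W t ++ openers ts) + suc (length ts)           ≡⟨ +-suc _ _ ⟩
    suc (ones (W t ++ openers ts) + length ts)           ≡⟨ cong (λ k → suc (k + length ts)) (ones-++ (W t) _) ⟩
    suc (ones (W t) + ones (openers ts) + length ts)     ≡⟨ cong suc (+-assoc (ones (W t)) _ _) ⟩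
    suc (ones (W t) + (ones (openers ts) + length ts))   ≡⟨ cong suc (cong₂ _+_ (trans (ones-W t) (sym (zeros-W t))) (bracket-openers ts)) ⟩
    suc (zeros (W t) + zeros (openers ts))               ≡⟨ cong suc (sym (zeros-++ (W t) _)) ⟩
    suc (zeros (W t ++ openers ts))                      ∎
  regroup : ∀ s z l o m → (s + ((z + l) + o)) + m ≡ (s + (z + (o + m))) + l
  regroup = solve-∀
  shuffle : ∀ s l m {o₁ z₁ o₂ z₂} → o₁ ≡ z₁ + l → o₂ + m ≡ z₂ →
    (s + (o₁ + o₂)) + m ≡ (s + (z₁ + z₂)) + l
  shuffle s l m {z₁ = z₁} {o₂ = o₂} refl refl = regroup s z₁ l o₂ m


-- There is one more unmatched opening bracket than closing ones. Once the opening ones are rotated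
-- to the front, the first of them is left over and all others find partners.
cycle-lemma-false : ∀ w → zeros w ≡ suc (ones w) → ∃₂ λ s j → w ≡ rots j (false ∷ W s)
cycle-lemma-false w c with parse w in pw
... | t , ts , es with trans (cong unparse (sym pw)) (unparse-parse w)
... | refl = rotated es excess
  where
  open ≡-Reasoning
  excess : length es ≡ suc (length ts)
  excess = +-cancelˡ-≡ (ones w) _ _
    (trans (count-parse t ts es) (trans (cong (_+ length ts) c) (sym (+-suc (ones w) _))))
  rotated : ∀ es → length es ≡ suc (length ts) →
    ∃₂ λ s j → W t ++ closers ts ++ openers es ≡ rots j (false ∷ W s)
  rotated (e ∷ es) l with match-brackets e es t ts 0
    (trans (sym (suc-injective l)) (sym (+-identityʳ _)))
  ... | s , [] , eq , _ = s , length (openers (e ∷ es)) , sym (begin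
    rots (length (openers (e ∷ es))) (false ∷ W s)
      ≡⟨ cong (λ z → rots (length (openers (e ∷ es))) (false ∷ z)) (sym (trans (trans (++-assoc (W e) _ _) eq) (++-identityʳ (W s)))) ⟩
    rots (length (openers (e ∷ es))) (openers (e ∷ es) ++ W t ++ closers ts)
      ≡⟨ rots-length-++ (openers (e ∷ es)) _ ⟩
    (W t ++ closers ts) ++ openers (e ∷ es)
      ≡⟨ ++-assoc (W t) (closers ts) _ ⟩
    W t ++ closers ts ++ openers (e ∷ es) ∎)

-- After the matching, the single surplus closing bracket stands between two balanced words; a
-- second rotation brings it to the front.
cycle-lemma-true : ∀ w → ones w ≡ suc (zeros w) → ∃₂ λ s j → w ≡ rots j (true ∷ W s)
cycle-lemma-true w c with parse w in pw
... | t , ts , es with trans (cong unparse (sym pw)) (unparse-parse w)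
... | refl with match-brackets leaf es t ts 1 excess
  where
  excess : length ts ≡ length es + 1
  excess = +-cancelˡ-≡ (zeros w) _ _
    (trans (sym (count-parse t ts es)) (trans (cong (_+ length es) c)
      (trans (sym (+-suc (zeros w) _)) (cong (zeros w +_) (+-comm 1 _)))))
... | s , x ∷ [] , eq , _ = s ⊕ x , length (true ∷ W x) + length (openers es) , sym (begin
    rots (length (true ∷ W x) + length (openers es)) (true ∷ W (s ⊕ x))
      ≡⟨ rots-+ (length (true ∷ W x)) _ _ ⟩
    rots (length (openers es)) (rots (length (true ∷ W x)) (true ∷ W (s ⊕ x)))
      ≡⟨ cong (λ z → rots (length (openers es)) (rots (length (true ∷ W x)) (true ∷ z))) (W-⊕ s x) ⟩
    rots (length (openers es)) (rots (length (true ∷ W x)) ((true ∷ W x) ++ W s))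
      ≡⟨ cong (rots (length (openers es))) (rots-length-++ (true ∷ W x) (W s)) ⟩
    rots (length (openers es)) (W s ++ true ∷ W x)
      ≡⟨ cong (rots (length (openers es))) (trans (cong (λ z → W s ++ true ∷ z) (sym (++-identityʳ (W x)))) (sym eq)) ⟩
    rots (length (openers es)) (openers es ++ W t ++ closers ts)
      ≡⟨ rots-length-++ (openers es) _ ⟩
    (W t ++ closers ts) ++ openers es
      ≡⟨ ++-assoc (W t) (closers ts) _ ⟩
    W t ++ closers ts ++ openers es ∎)
  where open ≡-Reasoning

-- Congruences and uniqueness of the rotation

infix 4 _≈_[mod_]

-- Multiples are added on both sides so that no subtraction of natural numbers occurs.
_≈_[mod_] : ℕ → ℕ → ℕ → Set
i ≈ j [mod N ] = ∃₂ λ a b → i + a * N ≡ j + b * N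

rots-multiple : ∀ a w → rots (a * length w) w ≡ w
rots-multiple zero    w = refl
rots-multiple (suc a) w = trans (rots-+ (length w) (a * length w) w)
  (trans (cong (rots (a * length w)) (rots-length w)) (rots-multiple a w))

rots-mod : ∀ {i j} w → i ≈ j [mod length w ] → rots i w ≡ rots j w
rots-mod {i} {j} w (a , b , e) = begin
  rots i w                          ≡⟨ unwind i a ⟩
  rots (i + a * length w) w         ≡⟨ cong (λ k → rots k w) e ⟩
  rots (j + b * length w) w         ≡⟨ sym (unwind j b) ⟩
  rots j w                          ∎
  where
  open ≡-Reasoning
  unwind : ∀ i a → rots i w ≡ rots (i + a * length w) w
  unwind i a = sym (begin
    rots (i + a * length w) w         ≡⟨ cong (λ k → rots k w) (+-comm i _) ⟩
    rots (a * length w + i) w         ≡⟨ rots-+ (a * length w) i w ⟩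
    rots i (rots (a * length w) w)    ≡⟨ cong (rots i) (rots-multiple a w) ⟩
    rots i w ∎)

remainder : ∀ N i → ∃₂ λ r a → r < suc N × i ≡ r + a * suc N
remainder N zero    = 0 , 0 , s≤s z≤n , refl
remainder N (suc i) with remainder N i
... | r , a , r<N , refl with m≤n⇒m<n∨m≡n r<N
... | inj₁ r+1<N = suc r , a , r+1<N , refl
... | inj₂ refl  = 0 , suc a , s≤s z≤n , refl

-- Under a nontrivial rotation the extra bracket `b` of each word falls strictly inside the other,
-- which splits `W s` and `W t` as `no-proper-rotation` forbids.
rotation-unique-< : ∀ b s t d → length (W s) ≡ length (W t) → d < length (b ∷ W t) →
  b ∷ W s ≡ rots d (b ∷ W t) → d ≡ 0 × s ≡ t
rotation-unique-< b s t zero    l d<N e = refl , W-injective (∷-injectiveʳ e)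
rotation-unique-< b s t (suc d) l d<N e = ⊥-elim (split (drop d (W t)) refl)
  where
  open ≡-Reasoning
  a = take d (W t)
  length-a : length a ≡ d
  length-a = trans (length-take d (W t)) (m≤n⇒m⊓n≡m (<⇒≤ (s≤s⁻¹ d<N)))
  halves : a ++ drop d (W t) ≡ W t
  halves = take++drop≡id d (W t)
  turned : b ∷ W s ≡ drop d (W t) ++ b ∷ a
  turned = begin
    b ∷ W s                                          ≡⟨ e ⟩
    rots (suc d) (b ∷ W t)                           ≡⟨ cong₂ (λ k w → rots (suc k) (b ∷ w)) (sym length-a) (sym halves) ⟩
    rots (length (b ∷ a)) ((b ∷ a) ++ drop d (W t))  ≡⟨ rots-length-++ (b ∷ a) _ ⟩
    drop d (W t) ++ b ∷ a                            ∎
  split : ∀ c → drop d (W t) ≡ c → ⊥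
  split []       ec = <-irrefl (begin
    d                  ≡⟨ sym length-a ⟩
    length a           ≡⟨ cong length (sym (++-identityʳ a)) ⟩
    length (a ++ [])   ≡⟨ cong (λ z → length (a ++ z)) (sym ec) ⟩
    length (a ++ drop d (W t)) ≡⟨ cong length halves ⟩
    length (W t)       ∎) (s≤s⁻¹ d<N)
  split (c₀ ∷ c) ec with trans turned (cong (_++ b ∷ a) ec)
  ... | e′ with ∷-injectiveˡ e′
  ... | refl = no-proper-rotation b a c s t (∷-injectiveʳ e′)
                 (trans (sym halves) (cong (a ++_) ec))

rotation-unique : ∀ b s t i j → size s ≡ size t → rots i (b ∷ W s) ≡ rots j (b ∷ W t) →
  s ≡ t × i ≈ j [mod length (b ∷ W t) ]
rotation-unique b s t i j ss e with remainder (length (W t)) i | remainder (length (W t)) j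
... | r , a , r<N , refl | r′ , a′ , r′<N , refl = reduce (≤-total r r′)
  where
  N = length (b ∷ W t)
  lengths : length (W s) ≡ length (W t)
  lengths = trans (length-W s) (trans (cong (2 *_) ss) (sym (length-W t)))
  drop-multiple : ∀ r a w → length w ≡ N → rots (r + a * N) w ≡ rots r w
  drop-multiple r a w l = rots-mod w (0 , a ,
    trans (+-identityʳ _) (cong (λ k → r + a * k) (sym l)))
  e′ : rots r (b ∷ W s) ≡ rots r′ (b ∷ W t)
  e′ = trans (sym (drop-multiple r a _ (cong suc lengths))) (trans e (drop-multiple r′ a′ _ refl))
  compare : ∀ {r r′} s t → length (W s) ≡ length (W t) → r′ < length (b ∷ W t) → r ≤ r′ →
    rots r (b ∷ W s) ≡ rots r′ (b ∷ W t) → r ≡ r′ × s ≡ t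
  compare {r} {r′} s t l r′<N r≤r′ e with rotation-unique-< b s t (r′ ∸ r) l
    (≤-<-trans (m∸n≤m r′ r) r′<N)
    (rots-injective r _ _ (trans e (trans (cong (λ k → rots k (b ∷ W t)) (sym (m∸n+n≡m r≤r′))) (rots-+ (r′ ∸ r) r _))))
  ... | d≡0 , s≡t = ≤-antisym r≤r′ (m∸n≡0⇒m≤n d≡0) , s≡t
  conclude : r ≡ r′ → r + a * N ≈ r′ + a′ * N [mod N ]
  conclude refl = a′ , a , trans (+-assoc r _ _) (trans (cong (r +_) (+-comm (a * N) _)) (sym (+-assoc r _ _)))
  reduce : r ≤ r′ ⊎ r′ ≤ r → s ≡ t × r + a * N ≈ r′ + a′ * N [mod N ]
  reduce (inj₁ r≤r′) with compare s t lengths r′<N r≤r′ e′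
  ... | r≡r′ , s≡t = s≡t , conclude r≡r′
  reduce (inj₂ r′≤r) with compare t s (sym lengths) (subst (r <_) (cong suc (sym lengths)) r<N) r′≤r (sym e′)
  ... | r′≡r , t≡s = sym t≡s , conclude (sym r′≡r)

-- Flips of one bit and bitstrings of fixed length

data Flip : List Bool → List Bool → Set where
  here  : ∀ {b w} → Flip (b ∷ w) (not b ∷ w)
  there : ∀ {b v w} → Flip v w → Flip (b ∷ v) (b ∷ w)

flip-at : ∀ b a {w} → Flip (a ++ b ∷ w) (a ++ not b ∷ w)
flip-at b []      = here
flip-at b (x ∷ a) = there (flip-at b a)

flip-++ : ∀ {v w} x → Flip v w → Flip (v ++ x) (w ++ x)
flip-++ x here      = here
flip-++ x (there f) = there (flip-++ x f)

flip-rotl : ∀ {v w} → Flip v w → Flip (rotl v) (rotl w)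
flip-rotl (here {b} {w}) = flip-at b w
flip-rotl (there f)      = flip-++ _ f

flip-rots : ∀ j {v w} → Flip v w → Flip (rots j v) (rots j w)
flip-rots zero    f = f
flip-rots (suc j) f = flip-rots j (flip-rotl f)

-- Lists of a wrong length are truncated or padded with false.
toVec : ∀ m → List Bool → Vec Bool m
toVec zero    w       = []
toVec (suc m) []      = false ∷ toVec m []
toVec (suc m) (b ∷ w) = b ∷ toVec m w

toVec-injective : ∀ {m} v w → length v ≡ m → length w ≡ m → toVec m v ≡ toVec m w → v ≡ w
toVec-injective []      []      refl ew e = refl
toVec-injective (x ∷ v) (y ∷ w) refl ew e with Vec.∷-injective e
... | refl , e′ = cong (x ∷_) (toVec-injective v w refl (suc-injective ew) e′)

toVec-toList : ∀ {m} (v : Vec Bool m) → toVec m (toList v) ≡ v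
toVec-toList []      = refl
toVec-toList (x ∷ v) = cong (x ∷_) (toVec-toList v)

weight-toVec : ∀ {m} w → length w ≡ m → weight (toVec m w) ≡ ones w
weight-toVec []          refl = refl
weight-toVec (true ∷ w)  refl = cong suc (weight-toVec w refl)
weight-toVec (false ∷ w) refl = weight-toVec w refl

ones-toList : ∀ {m} (v : Vec Bool m) → ones (toList v) ≡ weight v
ones-toList []          = refl
ones-toList (true ∷ v)  = cong suc (ones-toList v)
ones-toList (false ∷ v) = ones-toList v

hamming-refl : ∀ {m} (v : Vec Bool m) → hamming v v ≡ 0
hamming-refl []          = refl
hamming-refl (true ∷ v)  = hamming-refl v
hamming-refl (false ∷ v) = hamming-refl v

adjacent-sym : ∀ {m} (u v : Vec Bool m) → Adjacent u v → Adjacent v u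
adjacent-sym u v = trans (cong weight (Vec.zipWith-comm Bool.xor-comm v u))

flip-adjacent : ∀ {m v w} → Flip v w → length v ≡ m → Adjacent (toVec m v) (toVec m w)
flip-adjacent (here {true} {w})  refl = cong suc (hamming-refl (toVec (length w) w))
flip-adjacent (here {false} {w}) refl = cong suc (hamming-refl (toVec (length w) w))
flip-adjacent (there {true} f)  refl = flip-adjacent f refl
flip-adjacent (there {false} f) refl = flip-adjacent f refl

-- before and after are the two trees of a pull; the leaf is moved one step towards the root.
before after : Tree → Tree → Tree
before u v = node (node leaf u) v
after  u v = node leaf (node u v)

before≢after : ∀ {u v u′ v′} → before u v ≢ after u′ v′
before≢after ()

-- Middle vertices as rotated forests, and their edges

module Vertices (n : ℕ) where

  N : ℕ
  N = 2 * n + 1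

  length-b∷W : ∀ b t → size t ≡ n → length (b ∷ W t) ≡ N
  length-b∷W b t s = trans (cong suc (trans (length-W t) (cong (2 *_) s))) (+-comm 1 (2 * n))

  length-rots-W : ∀ b t j → size t ≡ n → length (rots j (b ∷ W t)) ≡ N
  length-rots-W b t j s = trans (length-rots j _) (length-b∷W b t s)

  abstract
    vertex : Bool → Tree → ℕ → BitStr n
    vertex b t j = toVec N (rots j (b ∷ W t))

    vertex-mod : ∀ b t {i j} → size t ≡ n → i ≈ j [mod N ] → vertex b t i ≡ vertex b t j
    vertex-mod b t {i} {j} s m = cong (toVec N)
      (rots-mod (b ∷ W t) (subst (i ≈ j [mod_]) (sym (length-b∷W b t s)) m))

    vertex-injective : ∀ b s t i j → size s ≡ n → size t ≡ n → vertex b s i ≡ vertex b t j →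
      s ≡ t × i ≈ j [mod N ]
    vertex-injective b s t i j ss st e
      with rotation-unique b s t i j (trans ss (sym st))
             (toVec-injective _ _ (length-rots-W b s i ss) (length-rots-W b t j st) e)
    ... | s≡t , m = s≡t , subst (i ≈ j [mod_]) (length-b∷W b t st) m

    ones-vertex : ∀ b t j → size t ≡ n → weight (vertex b t j) ≡ ones (b ∷ W t)
    ones-vertex b t j s = trans (weight-toVec (rots j (b ∷ W t)) (length-rots-W b t j s)) (ones-rots j (b ∷ W t))

    vertex-toList : ∀ {v} b s j → toList v ≡ rots j (b ∷ W s) → v ≡ vertex b s j
    vertex-toList {v} b s j e = trans (sym (toVec-toList v)) (cong (toVec N) e)

    flip-vertex : ∀ b c s t i k j → size s ≡ n → Flip (rots i (b ∷ W s)) (rots k (c ∷ W t)) →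
      Adjacent (vertex b s (i + j)) (vertex c t (k + j))
    flip-vertex b c s t i k j ss f = flip-adjacent
      (subst₂ Flip (sym (rots-+ i j _)) (sym (rots-+ k j _)) (flip-rots j f))
      (length-rots-W b s (i + j) ss)

  weight-lower : ∀ t j → size t ≡ n → weight (vertex false t j) ≡ n
  weight-lower t j s = trans (ones-vertex false t j s) (trans (ones-W t) s)

  weight-upper : ∀ t j → size t ≡ n → weight (vertex true t j) ≡ suc n
  weight-upper t j s = trans (ones-vertex true t j s) (cong suc (trans (ones-W t) s))

  vertex-middle : ∀ b t j → size t ≡ n → IsMiddleVertex n (vertex b t j)
  vertex-middle false t j s = inj₁ (weight-lower t j s)
  vertex-middle true  t j s = inj₂ (weight-upper t j s)

  lower≢upper : ∀ s t i j → size s ≡ n → size t ≡ n → vertex false s i ≢ vertex true t j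
  lower≢upper s t i j ss st e = 1+n≢n {n}
    (sym (trans (sym (weight-lower s i ss)) (trans (cong weight e) (weight-upper t j st))))

  -- Together with `vertex-injective` this identifies each layer with the pairs of a forest and a
  -- residue modulo `N`. The weight decides which form of the cycle lemma applies.
  vertex-surjective : ∀ v → IsMiddleVertex n v → ∃₂ λ b t → ∃ λ j → size t ≡ n × v ≡ vertex b t j
  vertex-surjective v m = choose m
    where
    w = toList v
    ones-w : ones w ≡ weight v
    ones-w = ones-toList v
    total : ones w + zeros w ≡ N
    total = trans (sym (length≡ones+zeros w)) (Vec.length-toList v)
    n+n : ∀ k → 2 * k + 1 ≡ k + suc k
    n+n = solve-∀
    choose : IsMiddleVertex n v → ∃₂ λ b t → ∃ λ j → size t ≡ n × v ≡ vertex b t j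
    choose (inj₁ wt) with cycle-lemma-false w
      (trans (+-cancelˡ-≡ n _ _ (trans (cong (_+ zeros w) (sym (trans ones-w wt))) (trans total (n+n n))))
             (cong suc (sym (trans ones-w wt))))
    ... | s , j , e = false , s , j ,
      trans (trans (sym (ones-W s)) (sym (ones-rots j _))) (trans (cong ones (sym e)) (trans ones-w wt)) ,
      vertex-toList false s j e
    choose (inj₂ wt) with cycle-lemma-true w
      (trans (trans ones-w wt) (cong suc (sym (+-cancelˡ-≡ (suc n) _ _
        (trans (cong (_+ zeros w) (sym (trans ones-w wt))) (trans total (trans (n+n n) (+-suc n n))))))))
    ... | s , j , e = true , s , j ,
      suc-injective (trans (trans (cong suc (sym (ones-W s))) (sym (ones-rots j (true ∷ W s)))) (trans (cong ones (sym e)) (trans ones-w wt))) ,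
      vertex-toList true s j e

  adjacent-flip : ∀ t j → size t ≡ n → Adjacent (vertex false t j) (vertex true t j)
  adjacent-flip t j s = flip-vertex false true t t 0 0 j s here

  -- Flipping the opening bracket of the first tree closes the leading `false` around `W v`. The
  -- last bracket thereby loses its partner and becomes the extra `true`, one rotation away from the
  -- front.
  adjacent-σ : ∀ t j → size t ≡ n → Adjacent (vertex false t j) (vertex true (σ t) (suc j))
  adjacent-σ leaf       j s = flip-vertex false true leaf leaf 0 1 j s here
  adjacent-σ (node u v) j s = flip-vertex false true (node u v) (u ⊕ node v leaf) 0 1 j s
    (subst (λ z → Flip (false ∷ W v ++ false ∷ W u ++ [ true ]) z) (sym word)
      (flip-at false (false ∷ W v)))
    where
    open ≡-Reasoning
    word : W (u ⊕ node v leaf) ++ [ true ] ≡ false ∷ W v ++ true ∷ W u ++ [ true ]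
    word = begin
      W (u ⊕ node v leaf) ++ [ true ]              ≡⟨ cong (_++ [ true ]) (W-⊕ u (node v leaf)) ⟩
      (W (node v leaf) ++ W u) ++ [ true ]         ≡⟨ ++-assoc (W (node v leaf)) (W u) _ ⟩
      W (node v leaf) ++ W u ++ [ true ]           ≡⟨ W-node-++ v leaf _ ⟩
      false ∷ W v ++ true ∷ W u ++ [ true ]        ∎

  -- The three new edges of the hexagon that glues the cycles of before u v and after u v.
  module Hexagon (u v : Tree) (j : ℕ) (size-before : size (before u v) ≡ n) where
    open ≡-Reasoning

    size-after : size (after u v) ≡ n
    size-after = size-before

    -- The root steps to the neighbour of the leaf, out to the leaf and back again; this turns the
    -- leaf into the last tree.
    third : Tree
    third = σ^ 3 (before u v)

    W-third : W third ≡ false ∷ true ∷ W (u ⊕ node v leaf)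
    W-third = W-⊕ (u ⊕ node v leaf) (node leaf leaf)

    W-u-v : ∀ w → W (u ⊕ node v leaf) ++ w ≡ false ∷ W v ++ true ∷ W u ++ w
    W-u-v w = trans (cong (_++ w) (W-⊕ u (node v leaf)))
      (trans (++-assoc (W (node v leaf)) (W u) w) (W-node-++ v leaf _))

    rots3 : ∀ b → rots 3 (b ∷ W third) ≡ false ∷ W v ++ true ∷ W u ++ b ∷ false ∷ true ∷ []
    rots3 b = begin
      rots 3 (b ∷ W third)                                   ≡⟨ cong (λ z → rots 3 (b ∷ z)) W-third ⟩
      rots 3 ((b ∷ false ∷ true ∷ []) ++ W (u ⊕ node v leaf)) ≡⟨ rots-length-++ (b ∷ false ∷ true ∷ []) _ ⟩
      W (u ⊕ node v leaf) ++ b ∷ false ∷ true ∷ []           ≡⟨ W-u-v _ ⟩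
      false ∷ W v ++ true ∷ W u ++ b ∷ false ∷ true ∷ []     ∎

    -- All six vertices are one rotation of a word `false ∷ W v ++ x ∷ W u ++ y ∷ z ∷ [ true ]`,
    -- where x, y, z are not all equal. Around the hexagon xyz runs through 001, 011, 010, 110, 100,
    -- 101 (1 for `true`), from `before u v` to the image of `before u v` under `σ`. The new edges
    -- are the first, third and fifth of these six steps.
    hexagon₁ : Adjacent (vertex false (before u v) j) (vertex true (σ (after u v)) (suc j))
    hexagon₁ = flip-vertex false true (before u v) (σ (after u v)) 0 1 j size-before
      (subst₂ Flip (sym lhs) (sym rhs) (flip-at false (false ∷ W v ++ false ∷ W u)))
      where
      lhs : false ∷ W (before u v) ≡ (false ∷ W v ++ false ∷ W u) ++ false ∷ true ∷ true ∷ []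
      lhs = cong (false ∷_) (trans
        (cong (λ z → W v ++ false ∷ z) (++-assoc (W u) (false ∷ true ∷ []) [ true ]))
        (sym (++-assoc (W v) (false ∷ W u) _)))
      rhs : rots 1 (true ∷ W (σ (after u v))) ≡ (false ∷ W v ++ false ∷ W u) ++ true ∷ true ∷ true ∷ []
      rhs = begin
        W (node (node u v) leaf) ++ [ true ]                       ≡⟨ W-node-++ (node u v) leaf _ ⟩
        false ∷ W (node u v) ++ true ∷ true ∷ []                   ≡⟨ cong (false ∷_) (W-node-++ u v _) ⟩
        false ∷ W v ++ false ∷ W u ++ true ∷ true ∷ true ∷ []      ≡⟨ cong (false ∷_) (sym (++-assoc (W v) (false ∷ W u) _)) ⟩
        (false ∷ W v ++ false ∷ W u) ++ true ∷ true ∷ true ∷ []    ∎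

    hexagon₂ : Adjacent (vertex false (after u v) j) (vertex true third (3 + j))
    hexagon₂ = flip-vertex false true (after u v) third 0 3 j size-after
      (subst₂ Flip (sym lhs) (sym (rots3 true)) (flip-at false (false ∷ W v)))
      where
      lhs : false ∷ W (after u v) ≡ false ∷ W v ++ false ∷ W u ++ true ∷ false ∷ true ∷ []
      lhs = cong (false ∷_) (W-node-++ u v (false ∷ true ∷ []))

    hexagon₃ : Adjacent (vertex false third (3 + j)) (vertex true (σ (before u v)) (suc j))
    hexagon₃ = flip-vertex false true third (σ (before u v)) 3 1 j
      (trans (size-σ^ 3 (before u v)) size-before)
      (subst₂ Flip (sym lhs) (sym rhs) (flip-at false (false ∷ W v ++ true ∷ W u ++ [ false ])))
      where
      regroup : ∀ w → W v ++ true ∷ W u ++ false ∷ w ≡ (W v ++ true ∷ W u ++ [ false ]) ++ w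
      regroup w = sym (trans (++-assoc (W v) _ w) (cong (λ z → W v ++ true ∷ z) (++-assoc (W u) [ false ] w)))
      lhs : rots 3 (false ∷ W third) ≡ (false ∷ W v ++ true ∷ W u ++ [ false ]) ++ false ∷ true ∷ []
      lhs = trans (rots3 false) (cong (false ∷_) (regroup (false ∷ true ∷ [])))
      rhs : rots 1 (true ∷ W (σ (before u v))) ≡ (false ∷ W v ++ true ∷ W u ++ [ false ]) ++ true ∷ true ∷ []
      rhs = begin
        (W (u ⊕ node v leaf) ++ false ∷ true ∷ []) ++ [ true ]     ≡⟨ ++-assoc (W (u ⊕ node v leaf)) _ _ ⟩
        W (u ⊕ node v leaf) ++ false ∷ true ∷ true ∷ []            ≡⟨ W-u-v _ ⟩
        false ∷ W v ++ true ∷ W u ++ false ∷ true ∷ true ∷ []      ≡⟨ cong (false ∷_) (regroup (true ∷ true ∷ [])) ⟩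
        (false ∷ W v ++ true ∷ W u ++ [ false ]) ++ true ∷ true ∷ []   ∎

-- Cycles as lists, and inserting a detour

module Lists {A : Set} where

  unique-resp-↭ : ∀ {xs ys : List A} → xs ↭ ys → Unique xs → Unique ys
  unique-resp-↭ p = SetoidPerm.Unique-resp-↭ (setoid A) (↭⇒↭ₛ p)

  unique-length : ∀ {xs ys : List A} → Unique xs → (∀ {x} → x ∈ xs → x ∈ ys) → length xs ≤ length ys
  unique-length {[]}     _        _ = z≤n
  unique-length {x ∷ xs} (x∉ ∷ u) f with ∈-∃++ (f (here refl))
  ... | as , bs , refl = subst (suc (length xs) ≤_) (sym (↭-length (shift x as bs)))
    (s≤s (unique-length u λ {y} y∈ → remove (All.lookup x∉ y∈) (∈-resp-↭ (shift x as bs) (f (there y∈)))))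
    where
    remove : ∀ {y} → x ≢ y → y ∈ x ∷ as ++ bs → y ∈ as ++ bs
    remove x≢y (here refl) = ⊥-elim (x≢y refl)
    remove x≢y (there y∈)  = y∈

  data Next : List A → A → A → Set where
    here  : ∀ {a b l} → Next (a ∷ b ∷ l) a b
    there : ∀ {x l a b} → Next l a b → Next (x ∷ l) a b

  next-++ʳ : ∀ l {r a b} → Next r a b → Next (l ++ r) a b
  next-++ʳ []      i = i
  next-++ʳ (x ∷ l) i = there (next-++ʳ l i)

  next-++ˡ : ∀ {l a b} r → Next l a b → Next (l ++ r) a b
  next-++ˡ r here      = here
  next-++ˡ r (there i) = there (next-++ˡ r i)

  next-reverse : ∀ {l a b} → Next l a b → Next (reverse l) b a
  next-reverse (here {a} {b} {l}) = subst (λ z → Next z b a)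
    (sym (reverse-++ (a ∷ b ∷ []) l)) (next-++ʳ (reverse l) here)
  next-reverse (there {x} {l} i) = subst (λ z → Next z _ _)
    (sym (unfold-reverse x l)) (next-++ˡ [ x ] (next-reverse i))

  -- The closing edge of a cyclic list is left out, since detours are inserted only between
  -- neighbours inside the list.
  Link : List A → A → A → Set
  Link l a b = Next l a b ⊎ Next l b a

  zip-functional : ∀ {xs ys : List A} {u v w} → Unique xs → (u , v) ∈ zip xs ys → (u , w) ∈ zip xs ys → v ≡ w
  zip-functional {x ∷ xs} {y ∷ ys} _ (here refl) (here refl) = refl
  zip-functional {x ∷ xs} {y ∷ ys} (x∉ ∷ _) (here refl) (there j) = ⊥-elim (All.lookup x∉ (left j) refl)
    where
    left : ∀ {xs ys : List A} {u v} → (u , v) ∈ zip xs ys → u ∈ xs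
    left {_ ∷ _} {_ ∷ _} (here refl) = here refl
    left {_ ∷ _} {_ ∷ _} (there i)   = there (left i)
  zip-functional {x ∷ xs} {y ∷ ys} (x∉ ∷ u) (there i) (here refl) = sym (zip-functional (x∉ ∷ u) (here refl) (there i))
  zip-functional {x ∷ xs} {y ∷ ys} (_ ∷ u) (there i) (there j) = zip-functional u i j

  zip-swap : ∀ {xs ys : List A} {u v} → (u , v) ∈ zip xs ys → (v , u) ∈ zip ys xs
  zip-swap {x ∷ xs} {y ∷ ys} (here refl) = here refl
  zip-swap {x ∷ xs} {y ∷ ys} (there i)   = there (zip-swap i)

  next-cyclic : ∀ {p l u v} → Next (p ∷ l) u v → (u , v) ∈ cyclicPairs (p ∷ l)
  next-cyclic {p} = go p
    where
    go : ∀ q {p l u v} → Next (p ∷ l) u v → (u , v) ∈ zip (p ∷ l) (l ++ [ q ])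
    go q here                    = here refl
    go q (there {l = x ∷ l} i)   = there (go q i)

  successor-unique : ∀ {c u v w} → Unique c → (u , v) ∈ cyclicPairs c → (u , w) ∈ cyclicPairs c → v ≡ w
  successor-unique {p ∷ l} uniq i j = zip-functional uniq i j

  predecessor-unique : ∀ {c u v w} → Unique c → (v , u) ∈ cyclicPairs c → (w , u) ∈ cyclicPairs c → v ≡ w
  predecessor-unique {p ∷ l} uniq i j = zip-functional (unique-resp-↭ (++-comm [ p ] l) uniq)
    (zip-swap {p ∷ l} i) (zip-swap {p ∷ l} j)

  module Walks (R : A → A → Set) (R-sym : ∀ {a b} → R a b → R b a) where

    -- the interior vertices of a walk from a to b
    Chain : A → List A → A → Set
    Chain a []       b = R a b
    Chain a (x ∷ xs) b = R a x × Chain x xs b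

    chain-++ : ∀ {a m b} xs {ys} → Chain a xs m → Chain m ys b → Chain a (xs ++ m ∷ ys) b
    chain-++ []       r       d = r , d
    chain-++ (x ∷ xs) (r , c) d = r , chain-++ xs c d

    chain-reverse : ∀ {a b} xs → Chain a xs b → Chain b (reverse xs) a
    chain-reverse []       r       = R-sym r
    chain-reverse (x ∷ xs) (r , c) = subst (λ l → Chain _ l _) (sym (unfold-reverse x xs))
      (chain-++ (reverse xs) (chain-reverse xs c) (R-sym r))

    chain-cyclic : ∀ {p l} → Chain p l p → All (λ e → R (proj₁ e) (proj₂ e)) (cyclicPairs (p ∷ l))
    chain-cyclic {p} {l} = go p l
      where
      go : ∀ {q} p l → Chain p l q → All (λ e → R (proj₁ e) (proj₂ e)) (zip (p ∷ l) (l ++ [ q ]))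
      go p []      r       = r ∷ []
      go p (x ∷ l) (r , c) = r ∷ go x l c

    splice-next : ∀ {p l q a b} d → Next (p ∷ l) a b → Chain p l q → Chain a d b →
      ∃ λ l′ → Chain p l′ q × p ∷ l′ ↭ d ++ p ∷ l ×
        (∀ {u v} → Next (p ∷ l) u v → ¬ (u ≡ a × v ≡ b) → Next (p ∷ l′) u v) ×
        (∀ {u v} → Next (a ∷ d ++ [ b ]) u v → Next (p ∷ l′) u v)
    splice-next {a = a} {b} d (here {l = r}) (_ , c) e =
      d ++ b ∷ r , chain-++ d e c , ↭-sym (shift a d (b ∷ r)) , old ,
      λ i → subst (λ z → Next (a ∷ z) _ _) (++-assoc d [ b ] r) (next-++ˡ r i)
      where
      old : ∀ {u v} → Next (a ∷ b ∷ r) u v → ¬ (u ≡ a × v ≡ b) → Next (a ∷ d ++ b ∷ r) u v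
      old here      ne = ⊥-elim (ne (refl , refl))
      old (there i) ne = there (next-++ʳ d i)
    splice-next {p} d (there {l = x ∷ r} i) (s , c) e with splice-next d i c e
    ... | r′ , c′ , perm , old , new = x ∷ r′ , (s , c′) ,
      ↭-trans (prep p perm) (↭-sym (shift p d (x ∷ r))) , old′ , λ j → there (new j)
      where
      old′ : ∀ {u v} → Next (p ∷ x ∷ r) u v → ¬ _ → Next (p ∷ x ∷ r′) u v
      old′ here      ne = here
      old′ (there j) ne = there (old j ne)

    record Splice (p : A) (l : List A) (a b : A) (d : List A) : Set where
      field
        tail  : List A
        chain : Chain p tail p
        perm  : p ∷ tail ↭ d ++ p ∷ l
        old   : ∀ {u v} → Link (p ∷ l) u v → ¬ (u ≡ a × v ≡ b) → ¬ (u ≡ b × v ≡ a) → Link (p ∷ tail) u v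
        new   : ∀ {u v} → Link (a ∷ d ++ [ b ]) u v → Link (p ∷ tail) u v

    abstract
      -- The cycle may run through the edge in either direction; if it goes from `b` to `a`, the
      -- reversed detour is inserted.
      splice : ∀ {p l a b} d → Link (p ∷ l) a b → Chain p l p → Chain a d b → Splice p l a b d
      splice {p} {l} {a} {b} d (inj₁ i) c e with splice-next d i c e
      ... | l′ , c′ , perm , old , new = record
        { tail = l′ ; chain = c′ ; perm = perm ; old = old′ ; new = λ { (inj₁ j) → inj₁ (new j) ; (inj₂ j) → inj₂ (new j) } }
        where
        old′ : ∀ {u v} → Link (p ∷ l) u v → ¬ (u ≡ a × v ≡ b) → ¬ (u ≡ b × v ≡ a) → Link (p ∷ l′) u v
        old′ (inj₁ j) n m = inj₁ (old j n)
        old′ (inj₂ j) n m = inj₂ (old j λ (x , y) → m (y , x))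
      splice {p} {l} {a} {b} d (inj₂ i) c e with splice-next (reverse d) i c (chain-reverse d e)
      ... | l′ , c′ , perm , old , new = record
        { tail = l′ ; chain = c′ ; perm = ↭-trans perm (++⁺ʳ (p ∷ l) (↭-reverse d)) ; old = old′
        ; new = λ { (inj₁ j) → inj₂ (new (turn j)) ; (inj₂ j) → inj₁ (new (turn j)) } }
        where
        old′ : ∀ {u v} → Link (p ∷ l) u v → ¬ (u ≡ a × v ≡ b) → ¬ (u ≡ b × v ≡ a) → Link (p ∷ l′) u v
        old′ (inj₁ j) n m = inj₁ (old j m)
        old′ (inj₂ j) n m = inj₂ (old j λ (x , y) → n (y , x))
        turn : ∀ {u v} → Next (a ∷ d ++ [ b ]) u v → Next (b ∷ reverse d ++ [ a ]) v u
        turn j = subst (λ z → Next z _ _)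
          (trans (unfold-reverse a (d ++ [ b ])) (cong (_++ [ a ]) (reverse-++ d [ b ]))) (next-reverse j)

-- A vertex has one successor and one predecessor, while two of three edges must leave it in the
-- same direction.
three-neighbours : ∀ {m c} {x a b e : Vec Bool m} → Unique c → EdgeOf c x a → EdgeOf c x b → EdgeOf c x e →
  a ≢ b → a ≢ e → b ≢ e → ⊥
three-neighbours {c = c} {x} {a} {b} {e} uniq = go
  where
  open Lists
  go : EdgeOf c x a → EdgeOf c x b → EdgeOf c x e → a ≢ b → a ≢ e → b ≢ e → ⊥
  go (inj₁ i) (inj₁ j) k        n _ _ = n (successor-unique uniq i j)
  go (inj₂ i) (inj₂ j) k        n _ _ = n (predecessor-unique uniq i j)
  go (inj₁ i) (inj₂ j) (inj₁ k) _ n _ = n (successor-unique uniq i k)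
  go (inj₁ i) (inj₂ j) (inj₂ k) _ _ n = n (predecessor-unique uniq j k)
  go (inj₂ i) (inj₁ j) (inj₁ k) _ _ n = n (successor-unique uniq j k)
  go (inj₂ i) (inj₁ j) (inj₂ k) _ n _ = n (predecessor-unique uniq i k)

-- Arithmetic of congruences

mod-sym : ∀ {N i j} → i ≈ j [mod N ] → j ≈ i [mod N ]
mod-sym (a , b , e) = b , a , sym e

mod-trans : ∀ {N i j k} → i ≈ j [mod N ] → j ≈ k [mod N ] → i ≈ k [mod N ]
mod-trans {N} {i} {j} {k} (a , b , e) (c , d , f) = a + c , d + b , (begin
  i + (a + c) * N        ≡⟨ split i a c N ⟩
  (i + a * N) + c * N    ≡⟨ cong (_+ c * N) e ⟩
  (j + b * N) + c * N    ≡⟨ swap j b c N ⟩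
  (j + c * N) + b * N    ≡⟨ cong (_+ b * N) f ⟩
  (k + d * N) + b * N    ≡⟨ sym (split k d b N) ⟩
  k + (d + b) * N        ∎)
  where
  open ≡-Reasoning
  split : ∀ i a c N → i + (a + c) * N ≡ (i + a * N) + c * N
  split = solve-∀
  swap : ∀ i a c N → (i + a * N) + c * N ≡ (i + c * N) + a * N
  swap = solve-∀

mod-suc : ∀ {N i j} → i ≈ j [mod N ] → suc i ≈ suc j [mod N ]
mod-suc (a , b , e) = a , b , cong suc e

mod-pred : ∀ {N i j} → suc i ≈ suc j [mod N ] → i ≈ j [mod N ]
mod-pred (a , b , e) = a , b , suc-injective e

mod-+ʳ : ∀ {N i j} k → i ≈ j [mod N ] → i + k ≈ j + k [mod N ]
mod-+ʳ {N} {i} {j} k (a , b , e) = a , b , trans (swap i k (a * N)) (trans (cong (_+ k) e) (swap j (b * N) k))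
  where
  swap : ∀ i k m → i + k + m ≡ i + m + k
  swap = solve-∀

mod-cancelʳ : ∀ {N i j} k → i + k ≈ j + k [mod N ] → i ≈ j [mod N ]
mod-cancelʳ {N} {i} {j} k (a , b , e) = a , b , +-cancelʳ-≡ k _ _ (trans (swap i (a * N) k) (trans e (swap j k (b * N))))
  where
  swap : ∀ i k m → i + k + m ≡ i + m + k
  swap = solve-∀

mod-zero : ∀ {N i} → i ≈ 0 [mod N ] → N ∣ i
mod-zero {N} {i} (a , b , e) = ∣m+n∣m⇒∣n (divides b (trans (+-comm (a * N) i) e)) (divides a refl)

mod-small : ∀ {N i} → 0 < i → i < N → ¬ i ≈ 0 [mod N ]
mod-small {i = suc i} _ i<N m = <-irrefl refl (<-≤-trans i<N (∣⇒≤ (mod-zero m)))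

-- The cycle of the 2-factor that belongs to one plane tree

module Orbit (n : ℕ) (n≥1 : 1 ≤ n) (t : Tree) (size-t : size t ≡ n) (s : ℕ) where

  open Vertices n
  open Lists {BitStr n}
  open Walks Adjacent (λ {u} {v} → adjacent-sym u v)

  -- the vertex of colour b visited at time m when the cycle of t is traversed
  at : Bool → ℕ → BitStr n
  at b m = vertex b (σ^ m t) (m + s)

  size-at : ∀ m → size (σ^ m t) ≡ n
  size-at m = trans (size-σ^ m t) size-t

  at-lower≢upper : ∀ i j → at false i ≢ at true j
  at-lower≢upper i j = lower≢upper _ _ (i + s) (j + s) (size-at i) (size-at j)

  Same : ℕ → ℕ → Set
  Same a b = σ^ a t ≡ σ^ b t × a ≈ b [mod N ]

  same-sym : ∀ {a b} → Same a b → Same b a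
  same-sym (e , m) = sym e , mod-sym m

  same-trans : ∀ {a b c} → Same a b → Same b c → Same a c
  same-trans (e , m) (f , k) = trans e f , mod-trans m k

  same-suc : ∀ {a b} → Same a b → Same (suc a) (suc b)
  same-suc (e , m) = cong σ e , mod-suc m

  same-cancel : ∀ c {a b} → Same (c + a) (c + b) → Same a b
  same-cancel zero    p       = p
  same-cancel (suc c) (e , m) = same-cancel c (σ-injective e , mod-pred m)

  same⇒≡ : ∀ b {i j} → Same i j → at b i ≡ at b j
  same⇒≡ b {i} {j} (e , m) = trans (cong (λ t → vertex b t (i + s)) e)
    (vertex-mod b (σ^ j t) (size-at j) (mod-+ʳ s m))

  ≡⇒same : ∀ b {i j} → at b i ≡ at b j → Same i j
  ≡⇒same b {i} {j} e with vertex-injective b _ _ _ _ (size-at i) (size-at j) e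
  ... | e′ , m = e′ , mod-cancelʳ s m

  same? : ∀ i j → Dec (Same i j)
  same? i j = map′ (≡⇒same true) (same⇒≡ true) (Vec.≡-dec Bool._≟_ (at true i) (at true j))

  record Return (K : ℕ) : Set where
    constructor return
    field
      positive : 0 < K
      returns  : Same K 0
      least    : ∀ i → 0 < i → i < K → ¬ Same i 0

  search : ∀ b → (∃ Return) ⊎ (∀ i → 0 < i → i ≤ b → ¬ Same i 0)
  search zero = inj₂ λ { (suc i) _ () }
  search (suc b) with search b
  ... | inj₁ found = inj₁ found
  ... | inj₂ none with same? (suc b) 0
  ... | yes p = inj₁ (suc b , return (s≤s z≤n) p (λ i i>0 i<b → none i i>0 (s≤s⁻¹ i<b)))
  ... | no ¬p = inj₂ λ i i>0 i≤b → case i i>0 (m≤n⇒m<n∨m≡n i≤b)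
    where
    case : ∀ i → 0 < i → i < suc b ⊎ i ≡ suc b → ¬ Same i 0
    case i i>0 (inj₁ i<b)  = none i i>0 (s≤s⁻¹ i<b)
    case i i>0 (inj₂ refl) = ¬p

  σ^-multiple : ∀ k m → σ^ (m + k * (n + n)) t ≡ σ^ m t
  σ^-multiple k m = trans (σ^-+ m (k * (n + n)) t)
    (cong (σ^ m) (trans (cong (λ n → σ^ (k * (n + n)) t) (sym size-t)) (σ-cycle t k)))

  abstract
    return-time : ∃ Return
    -- At this time both the forest, of period 2n, and the rotation, of period `N`, are back, so the
    -- search cannot fail.
    return-time with search (N * (n + n))
    ... | inj₁ found = found
    ... | inj₂ none  = ⊥-elim (none (N * (n + n)) pos ≤-refl
      (σ^-multiple N 0 , 0 , n + n , trans (+-identityʳ _) (*-comm N (n + n))))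
      where
      pos : 0 < N * (n + n)
      pos = *-mono-≤ (m≤n+m 1 (2 * n)) (≤-trans n≥1 (m≤m+n n n))

  K : ℕ
  K = proj₁ return-time

  open Return (proj₂ return-time) public

  same-distinct : ∀ {a b} → a < b → b ≤ K → 0 < a → ¬ Same a b
  same-distinct {a} {b} a<b b≤K a>0 p = least (b ∸ a) (m<n⇒0<n∸m a<b)
    (<-≤-trans (∸-monoʳ-< a>0 (<⇒≤ a<b)) b≤K)
    (same-sym (same-cancel a (subst₂ Same (sym (+-identityʳ a)) (sym (m+[n∸m]≡n (<⇒≤ a<b))) p)))

  -- Representatives are taken from 1 to `K` instead of 0 to `K` - 1, because these are the times
  -- that `run 0 K` lists.
  reduce : ∀ T → ∃ λ m → 0 < m × m ≤ K × Same T m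
  reduce zero = K , positive , ≤-refl , same-sym returns
  reduce (suc T) with reduce T
  ... | m , m>0 , m≤K , p with m≤n⇒m<n∨m≡n m≤K
  ... | inj₁ m<K  = suc m , s≤s z≤n , m<K , same-suc p
  ... | inj₂ refl = 1 , s≤s z≤n , positive , same-trans (same-suc p) (same-suc returns)

  -- Since 2n ≡ -1 modulo N, adding multiples of the period 2n of σ reaches every rotation.
  visited : ∀ i j → ∃ λ m → 0 < m × m ≤ K × σ^ i t ≡ σ^ m t × j ≈ m + s [mod N ]
  visited i j with reduce (i + (i + s + j * (n + n)) * (n + n))
  ... | m , m>0 , m≤K , (e , r) = m , m>0 , m≤K ,
    trans (sym (σ^-multiple (i + s + j * (n + n)) i)) e ,
    mod-trans (i + s + j * (n + n) , j , congruence i j s n) (mod-+ʳ s r)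
    where
    congruence : ∀ i j s n → j + (i + s + j * (n + n)) * (2 * n + 1) ≡
      (i + (i + s + j * (n + n)) * (n + n)) + s + j * (2 * n + 1)
    congruence = solve-∀

  visited-vertex : ∀ b i j → ∃ λ m → 0 < m × m ≤ K × vertex b (σ^ i t) j ≡ at b m
  visited-vertex b i j with visited i j
  ... | m , m>0 , m≤K , e , c = m , m>0 , m≤K ,
    trans (cong (λ t → vertex b t j) e) (vertex-mod b (σ^ m t) (size-at m) c)

  run : ℕ → ℕ → List (BitStr n)
  run i zero    = []
  run i (suc k) = at true (suc i) ∷ at false (suc i) ∷ run (suc i) k

  chain-run : ∀ i k {v} → Adjacent (at false (i + k)) v → Chain (at false i) (run i k) v
  chain-run i zero    {v} a = subst (λ i → Adjacent (at false i) v) (+-identityʳ i) a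
  chain-run i (suc k) {v} a =
    adjacent-σ (σ^ i t) (i + s) (size-at i) ,
    adjacent-sym (at false (suc i)) (at true (suc i)) (adjacent-flip (σ^ (suc i) t) (suc i + s) (size-at (suc i))) ,
    chain-run (suc i) k (subst (λ i → Adjacent (at false i) v) (+-suc i k) a)

  ∈-run⁻ : ∀ i k {v} → v ∈ run i k → ∃₂ λ b m → i < m × m ≤ i + k × v ≡ at b m
  ∈-run⁻ i (suc k) (here refl)         = true , suc i , ≤-refl , bound , refl
    where bound = subst (suc i ≤_) (sym (+-suc i k)) (s≤s (m≤m+n i k))
  ∈-run⁻ i (suc k) (there (here refl)) = false , suc i , ≤-refl , bound , refl
    where bound = subst (suc i ≤_) (sym (+-suc i k)) (s≤s (m≤m+n i k))
  ∈-run⁻ i (suc k) (there (there v∈)) with ∈-run⁻ (suc i) k v∈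
  ... | b , m , i<m , m≤ , e = b , m , <⇒≤ i<m , subst (m ≤_) (sym (+-suc i k)) m≤ , e

  ∈-run⁺ : ∀ b i k {m} → i < m → m ≤ i + k → at b m ∈ run i k
  ∈-run⁺ b i zero    i<m m≤ = ⊥-elim (<-irrefl refl (<-≤-trans i<m (subst (_ ≤_) (+-identityʳ i) m≤)))
  ∈-run⁺ b i (suc k) i<m m≤ with m≤n⇒m<n∨m≡n i<m
  ∈-run⁺ true  i (suc k) i<m m≤ | inj₂ refl = here refl
  ∈-run⁺ false i (suc k) i<m m≤ | inj₂ refl = there (here refl)
  ∈-run⁺ b     i (suc k) {m} i<m m≤ | inj₁ i+1<m =
    there (there (∈-run⁺ b (suc i) k i+1<m (subst (m ≤_) (+-suc i k) m≤)))

  unique-run : ∀ i k → i + k ≤ K → Unique (run i k)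
  unique-run i zero    _  = []
  unique-run i (suc k) le =
    ((λ e → at-lower≢upper (suc i) (suc i) (sym e)) ∷ All.tabulate (λ v∈ → apart true v∈)) ∷
    All.tabulate (λ v∈ → apart false v∈) ∷
    unique-run (suc i) k le′
    where
    le′ = subst (_≤ K) (+-suc i k) le
    apart : ∀ b {v} → v ∈ run (suc i) k → at b (suc i) ≢ v
    apart b v∈ e with ∈-run⁻ (suc i) k v∈
    apart true  v∈ e | true  , m , i<m , m≤ , refl = same-distinct i<m (≤-trans m≤ le′) (s≤s z≤n) (≡⇒same true e)
    apart false v∈ e | false , m , i<m , m≤ , refl = same-distinct i<m (≤-trans m≤ le′) (s≤s z≤n) (≡⇒same false e)
    apart true  v∈ e | false , m , i<m , m≤ , refl = at-lower≢upper m (suc i) (sym e)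
    apart false v∈ e | true  , m , i<m , m≤ , refl = at-lower≢upper (suc i) m e

  next-run : ∀ i k m → i < m → m < i + k → Next (run i k) (at false m) (at true (suc m))
  next-run i zero    m i<m m< = ⊥-elim (<-asym i<m (subst (m <_) (+-identityʳ i) m<))
  next-run i (suc k) m i<m m< with m≤n⇒m<n∨m≡n i<m
  ... | inj₁ i+1<m = there (there (next-run (suc i) k m i+1<m (subst (m <_) (+-suc i k) m<)))
  next-run i (suc zero)    m i<m m< | inj₂ refl = ⊥-elim (<-irrefl (sym (+-comm i 1)) m<)
  next-run i (suc (suc k)) m i<m m< | inj₂ refl = there here

  next-run-flip : ∀ i k m → i < m → m ≤ i + k → Next (run i k) (at true m) (at false m)
  next-run-flip i zero    m i<m m≤ = ⊥-elim (<-irrefl refl (<-≤-trans i<m (subst (m ≤_) (+-identityʳ i) m≤)))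
  next-run-flip i (suc k) m i<m m≤ with m≤n⇒m<n∨m≡n i<m
  ... | inj₁ i+1<m = there (there (next-run-flip (suc i) k m i+1<m (subst (m ≤_) (+-suc i k) m≤)))
  ... | inj₂ refl  = here

  cycle-tail : List (BitStr n)
  cycle-tail = at false 1 ∷ run 1 (K ∸ 1)

  cycle-is-run : at true 1 ∷ cycle-tail ≡ run 0 K
  cycle-is-run = cong (run 0) (m+[n∸m]≡n positive)

  adjacent-return : Adjacent (at false K) (at true 1)
  adjacent-return = subst (λ v → Adjacent v (at true 1)) (same⇒≡ false (same-sym returns))
    (adjacent-σ t s size-t)

  chain-cycle : Chain (at true 1) cycle-tail (at true 1)
  chain-cycle = proj₂ (subst (λ l → Chain (at false 0) l (at true 1)) (sym cycle-is-run)
    (chain-run 0 K adjacent-return))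

  -- The step that leaves time `K` closes the cycle and need not lie inside the list; the inequality
  -- excludes exactly its lower vertex. Every other step is one of those from the times 1 to `K` -
  -- 1.
  link-run : ∀ l → (∀ m → 0 < m → m < K → Link l (at false m) (at true (suc m))) →
    ∀ i j → vertex false (σ^ i t) j ≢ vertex false t s →
    Link l (vertex false (σ^ i t) j) (vertex true (σ^ (suc i) t) (suc j))
  link-run l link i j ne with visited i j
  ... | m , m>0 , m≤K , e , c with m≤n⇒m<n∨m≡n m≤K
  ... | inj₂ refl = ⊥-elim (ne (trans (cong (λ t → vertex false t j) e)
    (trans (vertex-mod false (σ^ K t) (size-at K) c) (same⇒≡ false returns))))
  ... | inj₁ m<K  = subst₂ (Link l)
    (sym (trans (cong (λ t → vertex false t j) e) (vertex-mod false (σ^ m t) (size-at m) c)))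
    (sym (trans (cong (λ t → vertex true (σ t) (suc j)) e) (vertex-mod true (σ^ (suc m) t) (size-at (suc m)) (mod-suc c))))
    (link m m>0 m<K)

star : ℕ → Tree
star zero    = leaf
star (suc k) = node leaf (star k)

size-star : ∀ k → size (star k) ≡ k
size-star zero    = refl
size-star (suc k) = cong suc (size-star k)

-- It shows the star to be the image under `σ` of the star rooted at one of its leaves, which is
-- where the initial cycle begins.
star-snoc : ∀ k → star k ⊕ node leaf leaf ≡ star (suc k)
star-snoc zero    = refl
star-snoc (suc k) = cong (node leaf) (star-snoc k)

-- Partial cycles and the detour through a new tree

module Gluing (n : ℕ) (n≥1 : 1 ≤ n) where

  open Vertices n
  open Lists {BitStr n}
  open Walks Adjacent (λ {u} {v} → adjacent-sym u v)

  abstract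
    -- A forest with a symmetry occurs repeatedly. Keeping the repetitions fixes the length at 2n
    -- for every tree.
    orbit : Tree → List Tree
    orbit t = map (λ i → σ^ i t) (upTo (n + n))

    length-orbit : ∀ t → length (orbit t) ≡ n + n
    length-orbit t = trans (length-map _ (upTo (n + n))) (length-upTo (n + n))

    ∈-orbit⁻ : ∀ {s t} → s ∈ orbit t → ∃ λ i → s ≡ σ^ i t
    ∈-orbit⁻ s∈ with ∈-map⁻ _ s∈
    ... | i , _ , e = i , e

    ∈-orbit⁺ : ∀ i {t} → size t ≡ n → σ^ i t ∈ orbit t
    ∈-orbit⁺ zero    {t} st = ∈-map⁺ (λ i → σ^ i t) (∈-upTo⁺ (≤-trans n≥1 (m≤m+n n n)))
    ∈-orbit⁺ (suc i) {t} st with ∈-map⁻ (λ i → σ^ i t) (∈-orbit⁺ i st)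
    ... | k , k∈ , e = subst (_∈ orbit t) (sym (cong σ e)) (close (m≤n⇒m<n∨m≡n (∈-upTo⁻ k∈)))
      where
      close : suc k < n + n ⊎ suc k ≡ n + n → σ^ (suc k) t ∈ orbit t
      close (inj₁ k<) = ∈-map⁺ (λ i → σ^ i t) (∈-upTo⁺ k<)
      close (inj₂ k≡) = subst (_∈ orbit t)
        (sym (trans (cong (λ m → σ^ m t) (trans k≡ (cong₂ _+_ (sym st) (sym st)))) (σ^-period t)))
        (∈-orbit⁺ zero st)

  -- The field `free` is the invariant of the induction: every pull from outside `S` into `S` still
  -- finds its edge inside the list, in all rotations.
  record Covering (S : List Tree) : Set where
    field
      start    : BitStr n
      rest     : List (BitStr n)
      chain    : Chain start rest start
      unique   : Unique (start ∷ rest)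
      sound    : ∀ {v} → v ∈ start ∷ rest → ∃₂ λ b t → ∃ λ j → t ∈ S × v ≡ vertex b t j
      complete : ∀ b {t} j → t ∈ S → vertex b t j ∈ start ∷ rest
      free     : ∀ u v j → after u v ∈ S → before u v ∉ S →
                 Link (start ∷ rest) (vertex false (after u v) j) (vertex true (σ (after u v)) (suc j))

    vertices : List (BitStr n)
    vertices = start ∷ rest

  open Covering

  -- Together c and d have three edges at x, too many for a single cycle.
  Distinguishes : ∀ {S T} → Covering S → Covering T → Set
  Distinguishes c d = ∃₂ λ u v → ∃ λ j → size (before u v) ≡ n × ∃₂ λ a b → ∃ λ e →
    let x = vertex false (before u v) j in
    Link (vertices c) x a × Link (vertices c) x b × Link (vertices d) x e × a ≢ b × a ≢ e × b ≢ e

  module Detour (u v : Tree) (size-before : size (before u v) ≡ n) (j : ℕ) where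

    open Orbit n n≥1 (before u v) size-before j
    open Hexagon u v j size-before

    N≥5 : 5 ≤ N
    N≥5 = subst (λ n → 5 ≤ 2 * n + 1) size-before (large (size u) (size v))
      where
      large : ∀ a b → 5 ≤ 2 * suc (suc (a + b)) + 1
      large a b = subst (5 ≤_) (expand a b) (m≤m+n 5 (2 * (a + b)))
        where
        expand : ∀ a b → 5 + 2 * (a + b) ≡ 2 * suc (suc (a + b)) + 1
        expand = solve-∀

    -- Time 3 must precede the return, so that a nonempty part of the cycle remains after it. As `K`
    -- is a positive multiple of `N` and the pattern `before u v` has at least two edges, `K` is at
    -- least 5.
    K>3 : 3 < K
    K>3 = ≰⇒> λ K≤3 → mod-small positive (≤-<-trans K≤3 (<-≤-trans (s≤s (s≤s (s≤s (s≤s z≤n)))) N≥5)) (proj₂ returns)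

    k : ℕ
    k = K ∸ 3

    3+k≡K : 3 + k ≡ K
    3+k≡K = m+[n∸m]≡n (<⇒≤ K>3)

    k>0 : 0 < k
    k>0 = m<n⇒0<n∸m K>3

    entry exit : BitStr n
    entry = vertex false (after u v) j
    exit  = vertex true (σ (after u v)) (suc j)

    -- The first steps of the cycle are taken backwards, between two of the new edges of the hexagon;
    -- the third new edge leads to exit.
    detour : List (BitStr n)
    detour = at true 3 ∷ at false 2 ∷ at true 2 ∷ at false 1 ∷ at true 1 ∷ at false 3 ∷ run 3 k

    walk : List (BitStr n)
    walk = entry ∷ detour ++ [ exit ]

    abstract
      detour-↭ : detour ↭ run 0 K
      detour-↭ = subst (λ K → detour ↭ run 0 K) 3+k≡K
        (++⁺ʳ (at false 3 ∷ run 3 k) (↭-reverse (at true 1 ∷ at false 1 ∷ at true 2 ∷ at false 2 ∷ at true 3 ∷ [])))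

    x≡last : at false (3 + k) ≡ at false 0
    x≡last = same⇒≡ false (subst (λ K → Same K 0) (sym 3+k≡K) returns)

    chain-detour : Chain entry detour exit
    chain-detour =
      hexagon₂ ,
      back (at false 2) (at true 3) (adjacent-σ (σ^ 2 D) (2 + j) (size-at 2)) ,
      adjacent-flip (σ^ 2 D) (2 + j) (size-at 2) ,
      back (at false 1) (at true 2) (adjacent-σ (σ^ 1 D) (1 + j) (size-at 1)) ,
      adjacent-flip (σ^ 1 D) (1 + j) (size-at 1) ,
      back (at false 3) (at true 1) hexagon₃ ,
      chain-run 3 k (subst (λ x → Adjacent x exit) (sym x≡last) hexagon₁)
      where
      D = before u v
      back : ∀ a b → Adjacent a b → Adjacent b a
      back = adjacent-sym

    in-walk : ∀ {a b} → Link detour a b → Link walk a b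
    in-walk (inj₁ i) = inj₁ (there (next-++ˡ [ exit ] i))
    in-walk (inj₂ i) = inj₂ (there (next-++ˡ [ exit ] i))

    -- The detour drops the `σ`-edge that leaves `before u v` at rotation `j` and the edge between
    -- the two vertices at time 3. The latter is no `σ`-edge, so all other `σ`-edges survive, some
    -- of them traversed backwards.
    link-detour : ∀ i m → vertex false (σ^ i (before u v)) m ≢ vertex false (before u v) j →
      Link walk (vertex false (σ^ i (before u v)) m) (vertex true (σ^ (suc i) (before u v)) (suc m))
    link-detour i m ne = in-walk (link-run detour links i m ne)
      where
      first : ∀ k → 0 < k → Next (at false 3 ∷ run 3 k) (at false 3) (at true 4)
      first (suc k) _ = here
      links : ∀ m → 0 < m → m < K → Link detour (at false m) (at true (suc m))
      links 1 _ _ = inj₂ (there (there here))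
      links 2 _ _ = inj₂ here
      links 3 _ _ = inj₁ (there (there (there (there (there (first k k>0))))))
      links m@(suc (suc (suc (suc _)))) _ m<K = inj₁ (next-++ʳ
        (at true 3 ∷ at false 2 ∷ at true 2 ∷ at false 1 ∷ at true 1 ∷ at false 3 ∷ [])
        (next-run 3 k m (s≤s (s≤s (s≤s (s≤s z≤n)))) (subst (m <_) (sym 3+k≡K) m<K)))

    link-exit : Link walk (vertex false (before u v) j) exit
    link-exit = inj₁ (subst (λ x → Next walk x exit) x≡last
      (next-++ʳ (entry ∷ at true 3 ∷ at false 2 ∷ at true 2 ∷ at false 1 ∷ at true 1 ∷ at false 3 ∷ []) (last 3 k k>0)))
      where
      last : ∀ i k → 0 < k → Next (run i k ++ [ exit ]) (at false (i + k)) exit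
      last i (suc zero)    _ = subst (λ m → Next (run i 1 ++ [ exit ]) (at false m) exit) (+-comm 1 i) (there here)
      last i (suc (suc k)) _ = there (there (subst (λ m → Next (run (suc i) (suc k) ++ [ exit ]) (at false m) exit)
        (sym (+-suc i (suc k))) (last (suc i) (suc k) (s≤s z≤n))))

    link-flip : Link walk (vertex false (before u v) j) (vertex true (before u v) j)
    link-flip = in-walk (inj₂ (subst₂ (λ y x → Next detour y x)
      (same⇒≡ true (subst (λ K → Same K 0) (sym 3+k≡K) returns)) x≡last
      (next-++ʳ (at true 3 ∷ at false 2 ∷ at true 2 ∷ at false 1 ∷ at true 1 ∷ at false 3 ∷ [])
        (next-run-flip 3 k (3 + k) (+-monoʳ-≤ 3 k>0) ≤-refl))))

-- Attaching trees and doubling the number of cycles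

module Build (n : ℕ) (n≥1 : 1 ≤ n) where

  open Vertices n
  open Lists {BitStr n}
  open Walks Adjacent (λ {u} {v} → adjacent-sym u v)
  open Gluing n n≥1
  open Covering

  σ^-closed : ∀ {S} → (∀ {t} → t ∈ S → σ t ∈ S) → ∀ i {t} → t ∈ S → σ^ i t ∈ S
  σ^-closed closed zero    t∈ = t∈
  σ^-closed closed (suc i) t∈ = closed (σ^-closed closed i t∈)

  module Glue (S : List Tree) (sized : ∀ {t} → t ∈ S → size t ≡ n) (closed : ∀ {t} → t ∈ S → σ t ∈ S)
              (u v : Tree) (size-before : size (before u v) ≡ n)
              (fresh : before u v ∉ S) (reached : after u v ∈ S) where

    orbit-fresh : ∀ i → σ^ i (before u v) ∉ S
    orbit-fresh i σ∈ with σ^-return i (before u v)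
    ... | m , e = fresh (subst (_∈ S) e (σ^-closed closed m σ∈))

    module _ (j : ℕ) (c : Covering S) where

      open Orbit n n≥1 (before u v) size-before j
      open Detour u v size-before j

      spliced : Splice (start c) (rest c) entry exit detour
      spliced = splice detour (free c u v j reached fresh) (chain c) chain-detour

      open Splice spliced using (tail; perm) renaming (chain to chain′; old to old′; new to new′)

      abstract
        -- Up to order, the new cycle is the union of the two old ones; its vertex set and the
        -- absence of repetitions are read off from this.
        perm′ : start c ∷ tail ↭ run 0 K ++ vertices c
        perm′ = ↭-trans perm (++⁺ʳ (vertices c) detour-↭)

      disjoint : ∀ {x} → x ∈ run 0 K → x ∈ vertices c → ⊥
      disjoint x∈run x∈c with ∈-run⁻ 0 K x∈run | sound c x∈c
      ... | true  , m , _ , _ , refl | false , t , i , t∈ , e =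
        lower≢upper t _ i (m + j) (sized t∈) (size-at m) (sym e)
      ... | false , m , _ , _ , refl | true  , t , i , t∈ , e =
        lower≢upper _ t (m + j) i (size-at m) (sized t∈) e
      ... | true  , m , _ , _ , refl | true  , t , i , t∈ , e =
        orbit-fresh m (subst (_∈ S) (sym (proj₁ (vertex-injective true _ t (m + j) i (size-at m) (sized t∈) e))) t∈)
      ... | false , m , _ , _ , refl | false , t , i , t∈ , e =
        orbit-fresh m (subst (_∈ S) (sym (proj₁ (vertex-injective false _ t (m + j) i (size-at m) (sized t∈) e))) t∈)

      glue-sound : ∀ {x} → x ∈ start c ∷ tail → ∃₂ λ b t → ∃ λ i → t ∈ orbit (before u v) ++ S × x ≡ vertex b t i
      glue-sound {x} x∈ = locate (∈-++⁻ (run 0 K) (∈-resp-↭ perm′ x∈))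
        where
        locate : x ∈ run 0 K ⊎ x ∈ vertices c → ∃₂ λ b t → ∃ λ i → t ∈ orbit (before u v) ++ S × x ≡ vertex b t i
        locate (inj₁ x∈run) = let b , m , _ , _ , e = ∈-run⁻ 0 K x∈run in
          b , σ^ m (before u v) , m + j , ∈-++⁺ˡ {ys = S} (∈-orbit⁺ m size-before) , e
        locate (inj₂ x∈c) = let b , t , i , t∈ , e = sound c x∈c in
          b , t , i , ∈-++⁺ʳ (orbit (before u v)) t∈ , e

      glue-complete : ∀ b {t} i → t ∈ orbit (before u v) ++ S → vertex b t i ∈ start c ∷ tail
      glue-complete b {t} i t∈ = ∈-resp-↭ (↭-sym perm′) (locate (∈-++⁻ (orbit (before u v)) t∈))
        where
        locate : t ∈ orbit (before u v) ⊎ t ∈ S → vertex b t i ∈ run 0 K ++ vertices c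
        locate (inj₂ t∈S) = ∈-++⁺ʳ (run 0 K) (complete c b i t∈S)
        locate (inj₁ t∈o) =
          let k , t≡ = ∈-orbit⁻ t∈o
              m , m>0 , m≤K , e = visited-vertex b k i
          in ∈-++⁺ˡ (subst (_∈ run 0 K) (sym (trans (cong (λ t → vertex b t i) t≡) e)) (∈-run⁺ b 0 K m>0 m≤K))

      -- Only an edge at the tree after u v is lost.
      link-kept : ∀ {t i w} → size t ≡ n → t ≢ after u v → Link (vertices c) (vertex false t i) w →
        Link (start c ∷ tail) (vertex false t i) w
      link-kept {t} {i} st t≢ l = old′ l
        (λ (e , _) → t≢ (proj₁ (vertex-injective false t (after u v) i j st (sized reached) e)))
        (λ (e , _) → lower≢upper t (σ (after u v)) i (suc j) st (trans (size-σ (after u v)) (sized reached)) e)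

      -- For `after a b` in `S`, losing the edge would mean `after a b` is `after u v`, but then
      -- `before a b` would just have been attached. For `after a b` in the new orbit, the only
      -- missing `σ`-edges start at a forest of the form `before u v`.
      glue-free : ∀ a b i → after a b ∈ orbit (before u v) ++ S → before a b ∉ orbit (before u v) ++ S →
        Link (start c ∷ tail) (vertex false (after a b) i) (vertex true (σ (after a b)) (suc i))
      glue-free a b i a∈ b∉ = kept-or-new (∈-++⁻ (orbit (before u v)) a∈)
        where
        different : after a b ≢ after u v
        different refl = b∉ (∈-++⁺ˡ (∈-orbit⁺ 0 size-before))
        kept-or-new : after a b ∈ orbit (before u v) ⊎ after a b ∈ S →
          Link (start c ∷ tail) (vertex false (after a b) i) (vertex true (σ (after a b)) (suc i))
        kept-or-new (inj₂ a∈S) = link-kept (sized a∈S) different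
          (free c a b i a∈S (λ b∈ → b∉ (∈-++⁺ʳ (orbit (before u v)) b∈)))
        kept-or-new (inj₁ a∈o) = let m , e = ∈-orbit⁻ a∈o in
          subst (λ t → Link (start c ∷ tail) (vertex false t i) (vertex true (σ t) (suc i))) (sym e)
            (new′ (link-detour m i λ e′ → before≢after (sym (trans e (proj₁
              (vertex-injective false _ _ i j (size-at m) size-before e′))))))

      abstract
        glue : Covering (orbit (before u v) ++ S)
        glue = record
          { start    = start c
          ; rest     = tail
          ; chain    = chain′
          ; unique   = unique-resp-↭ (↭-sym perm′)
                         (Unique.++⁺ (unique-run 0 K ≤-refl) (unique c) (λ (x , y) → disjoint x y))
          ; sound    = glue-sound
          ; complete = glue-complete
          ; free     = glue-free
          }

        glue-exit : Link (vertices glue) (vertex false (before u v) j) exit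
        glue-exit = new′ link-exit

        glue-flip : Link (vertices glue) (vertex false (before u v) j) (vertex true (before u v) j)
        glue-flip = new′ link-flip

        glue-σ : ∀ i → ¬ i ≈ j [mod N ] →
          Link (vertices glue) (vertex false (before u v) i) (vertex true (σ (before u v)) (suc i))
        glue-σ i i≉j = new′ (link-detour 0 i λ e → i≉j (proj₂ (vertex-injective false _ _ i j size-before size-before e)))

        glue-kept : ∀ {t i w} → size t ≡ n → t ≢ after u v → Link (vertices c) (vertex false t i) w →
          Link (vertices glue) (vertex false t i) w
        glue-kept = link-kept

    -- The three recorded edges meet at a lower vertex of a forest `before a b`, whereas gluing only
    -- removes an edge of the old cycle at `after u v`.
    glue-keeps-distinct : ∀ i j c d → Distinguishes c d → Distinguishes (glue i c) (glue j d)
    glue-keeps-distinct i j c d (a , b , m , sb , y , z , w , l , l′ , l″ , ne) =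
      a , b , m , sb , y , z , w ,
      glue-kept i c sb before≢after l , glue-kept i c sb before≢after l′ , glue-kept j d sb before≢after l″ , ne

    -- The vertex of `before u v` at rotation 0 tells the two apart: a hexagon at rotation 0 trades
    -- its `σ`-edge for the edge to the exit, a hexagon at rotation 1 leaves the `σ`-edge in place.
    glue-distinguishes : ∀ c d → Distinguishes (glue 0 c) (glue 1 d)
    glue-distinguishes c d = u , v , 0 , size-before , _ , _ , _ ,
      glue-exit 0 c , glue-flip 0 c , glue-σ 1 d 0 (λ m → one≉zero (mod-sym m)) ,
      (λ e → one≉zero (proj₂ (vertex-injective true (σ (after u v)) (before u v) 1 0 size-σ-after size-before e))) ,
      (λ e → before≢after (sym (σ-injective (proj₁ (vertex-injective true (σ (after u v)) (σ (before u v)) 1 1 size-σ-after size-σ-before e))))) ,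
      (λ e → one≉zero (mod-sym (proj₂ (vertex-injective true (before u v) (σ (before u v)) 0 1 size-before size-σ-before e))))
      where
      size-σ-after : size (σ (after u v)) ≡ n
      size-σ-after = trans (size-σ (after u v)) size-before
      size-σ-before : size (σ (before u v)) ≡ n
      size-σ-before = trans (size-σ (before u v)) size-before
      one≉zero : ¬ 1 ≈ 0 [mod N ]
      one≉zero = mod-small (s≤s z≤n) (+-monoˡ-≤ 1 (≤-trans n≥1 (m≤m+n n (1 * n))))

  Distinct : ∀ {S} → Covering S → Covering S → Set
  Distinct c d = Distinguishes c d ⊎ Distinguishes d c

  record Family : Set where
    field
      trees        : List Tree
      sized        : ∀ {t} → t ∈ trees → size t ≡ n
      closed       : ∀ {t} → t ∈ trees → σ t ∈ trees
      has-star     : star n ∈ trees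
      coverings    : List (Covering trees)
      distinct     : AllPairs Distinct coverings
      choices      : ℕ
      length-trees : length trees ≡ suc choices * (n + n)
      count        : length coverings ≡ 2 ^ choices

  open Family

  infix 4 _⊆ᵀ_

  _⊆ᵀ_ : Family → Family → Set
  F ⊆ᵀ G = ∀ {t} → t ∈ trees F → t ∈ trees G

  -- Each cycle is continued in two ways. Different continuations are distinguished by the new tree
  -- whatever they continue; equal ones inherit the difference of the cycles they continue.
  attach : ∀ F u v → size (before u v) ≡ n → before u v ∉ trees F → after u v ∈ trees F →
    ∃ λ G → F ⊆ᵀ G × before u v ∈ trees G
  attach F u v sb fresh reached = G , ∈-++⁺ʳ (orbit (before u v)) , ∈-++⁺ˡ (∈-orbit⁺ 0 sb)
    where
    open Glue (trees F) (sized F) (closed F) u v sb fresh reached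

    glued : ℕ → List (Covering (orbit (before u v) ++ trees F))
    glued j = map (glue j) (coverings F)

    glued-distinct : ∀ j → AllPairs Distinct (glued j)
    glued-distinct j = AllPairs.map⁺ (AllPairs.map kept (distinct F))
      where
      kept : ∀ {c d} → Distinct c d → Distinct (glue j c) (glue j d)
      kept {c} {d} (inj₁ p) = inj₁ (glue-keeps-distinct j j c d p)
      kept {c} {d} (inj₂ p) = inj₂ (glue-keeps-distinct j j d c p)

    G : Family
    G = record
      { trees        = orbit (before u v) ++ trees F
      ; sized        = λ t∈ → sized′ (∈-++⁻ (orbit (before u v)) t∈)
      ; closed       = λ t∈ → closed′ (∈-++⁻ (orbit (before u v)) t∈)
      ; has-star     = ∈-++⁺ʳ (orbit (before u v)) (has-star F)
      ; coverings    = glued 0 ++ glued 1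
      ; distinct     = AllPairs.++⁺ (glued-distinct 0) (glued-distinct 1)
          (All.map⁺ (All.universal (λ c → All.map⁺ (All.universal (λ d → inj₁ (glue-distinguishes c d)) (coverings F))) (coverings F)))
      ; choices      = suc (choices F)
      ; length-trees = trans (length-++ (orbit (before u v))) (cong₂ _+_ (length-orbit (before u v)) (length-trees F))
      ; count        = trans (length-++ (glued 0)) (cong₂ _+_ (length-glued 0) (trans (length-glued 1) (sym (+-identityʳ _))))
      }
      where
      length-glued : ∀ j → length (glued j) ≡ 2 ^ choices F
      length-glued j = trans (length-map (glue j) (coverings F)) (count F)
      sized′ : ∀ {t} → t ∈ orbit (before u v) ⊎ t ∈ trees F → size t ≡ n
      sized′ (inj₂ t∈) = sized F t∈
      sized′ (inj₁ t∈) = let i , e = ∈-orbit⁻ t∈ in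
        trans (cong size e) (trans (size-σ^ i (before u v)) sb)
      closed′ : ∀ {t} → t ∈ orbit (before u v) ⊎ t ∈ trees F → σ t ∈ orbit (before u v) ++ trees F
      closed′ (inj₂ t∈) = ∈-++⁺ʳ (orbit (before u v)) (closed F t∈)
      closed′ (inj₁ t∈) = let i , e = ∈-orbit⁻ t∈ in
        subst (_∈ orbit (before u v) ++ trees F) (sym (cong σ e)) (∈-++⁺ˡ (∈-orbit⁺ (suc i) sb))

  -- The closing edge of the list belongs to a tree that is not of the form after u v, so that
  -- no detour ever has to replace it.
  initial : ∀ m → n ≡ suc m → Family
  initial m refl = record
    { trees        = orbit t
    ; sized        = λ t∈ → sized′ (∈-orbit⁻ t∈)
    ; closed       = λ t∈ → closed′ (∈-orbit⁻ t∈)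
    ; has-star     = subst (_∈ orbit t) (star-snoc m) (∈-orbit⁺ 1 size-t)
    ; coverings    = record
        { start    = at true 1
        ; rest     = cycle-tail
        ; chain    = chain-cycle
        ; unique   = subst Unique (sym cycle-is-run) (unique-run 0 K ≤-refl)
        ; sound    = λ x∈ → sound′ (∈-run⁻ 0 K (subst (_ ∈_) cycle-is-run x∈))
        ; complete = λ b j t∈ → complete′ b j (∈-orbit⁻ t∈)
        ; free     = λ u v j a∈ _ → free′ u v j (∈-orbit⁻ a∈)
        } ∷ []
    ; distinct     = [] ∷ []
    ; choices      = 0
    ; length-trees = trans (length-orbit t) (sym (+-identityʳ (n + n)))
    ; count        = refl
    }
    where
    t : Tree
    t = node (star m) leaf
    size-t : size t ≡ suc m
    size-t = cong suc (trans (+-identityʳ _) (size-star m))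
    open Orbit n n≥1 t size-t 0
    sized′ : ∀ {s} → (∃ λ i → s ≡ σ^ i t) → size s ≡ n
    sized′ (i , refl) = size-at i
    closed′ : ∀ {s} → (∃ λ i → s ≡ σ^ i t) → σ s ∈ orbit t
    closed′ (i , refl) = ∈-orbit⁺ (suc i) size-t
    sound′ : ∀ {x} → (∃₂ λ b m → 0 < m × m ≤ K × x ≡ at b m) →
      ∃₂ λ b s → ∃ λ j → s ∈ orbit t × x ≡ vertex b s j
    sound′ (b , m , _ , _ , e) = b , σ^ m t , m + 0 , ∈-orbit⁺ m size-t , e
    complete′ : ∀ b {s} j → (∃ λ i → s ≡ σ^ i t) → vertex b s j ∈ at true 1 ∷ cycle-tail
    complete′ b j (i , refl) = let k , k>0 , k≤K , e = visited-vertex b i j in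
      subst (vertex b (σ^ i t) j ∈_) (sym cycle-is-run)
        (subst (_∈ run 0 K) (sym e) (∈-run⁺ b 0 K k>0 k≤K))
    free′ : ∀ u v j → (∃ λ i → after u v ≡ σ^ i t) →
      Link (at true 1 ∷ cycle-tail) (vertex false (after u v) j) (vertex true (σ (after u v)) (suc j))
    free′ u v j (i , e) = subst₂ (λ l s → Link l (vertex false s j) (vertex true (σ s) (suc j)))
      (sym cycle-is-run) (sym e)
      (link-run (run 0 K) (λ k k>0 k<K → inj₁ (next-run 0 K k k>0 k<K)) i j
        λ e′ → after≢t (trans e (proj₁ (vertex-injective false _ t j 0 (size-at i) size-t e′))))
      where
      after≢t : after u v ≢ t
      after≢t ()

-- Pulls and the descent to the star

-- This is the sum of all depths when the children of the root have depth 0. It depends on the root,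
-- so the descent compares forests before any move of the root.
area : Tree → ℕ
area leaf       = 0
area (node u v) = size u + area u + area v

-- Pull k s t: somewhere in s the pattern before u v is replaced by after u v, and applying σ
-- k times brings that place to the root.
data Pull : ℕ → Tree → Tree → Set where
  root  : ∀ {u v} → Pull 0 (before u v) (after u v)
  left  : ∀ {k u u′ v} → Pull k u u′ → Pull (suc k) (node u v) (node u′ v)
  right : ∀ {k u v v′} → Pull k v v′ → Pull (suc (suc (size u + size u + k))) (node u v) (node u v′)

pull-size : ∀ {k s t} → Pull k s t → size s ≡ size t
pull-size root              = refl
pull-size (left {v = v} p)  = cong (λ k → suc (k + size v)) (pull-size p)
pull-size (right {u = u} p) = cong (λ k → suc (size u + k)) (pull-size p)

pull-area : ∀ {k s t} → Pull k s t → area s ≡ suc (area t)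
pull-area (root {u} {v}) = cong suc (shuffle (size u) (area u) (area v))
  where
  shuffle : ∀ x y z → x + (0 + y) + z ≡ x + y + z
  shuffle = solve-∀
pull-area (left {u = u} {u′} {v} p) = trans (cong₂ (λ x y → x + y + area v) (pull-size p) (pull-area p))
  (cong (_+ area v) (+-suc (size u′) (area u′)))
pull-area (right {u = u} p) = trans (cong (size u + area u +_) (pull-area p)) (+-suc _ _)

pull-⊕ˡ : ∀ {k s s′} t → Pull k s s′ → Pull k (s ⊕ t) (s′ ⊕ t)
pull-⊕ˡ t root      = root
pull-⊕ˡ t (left p)  = left p
pull-⊕ˡ t (right p) = right (pull-⊕ˡ t p)

pull-⊕ʳ : ∀ s {k t t′} → Pull k t t′ → Pull (size s + size s + k) (s ⊕ t) (s ⊕ t′)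
pull-⊕ʳ leaf       p = p
pull-⊕ʳ (node a b) {k} {t} {t′} p = subst (λ k → Pull k (node a (b ⊕ t)) (node a (b ⊕ t′))) (shuffle (size a) (size b) k) (right (pull-⊕ʳ b p))
  where
  shuffle : ∀ x y k → suc (suc (x + x + (y + y + k))) ≡ suc (x + y) + suc (x + y) + k
  shuffle = solve-∀

-- Applying `σ` to both forests lowers the index by one: a `left` pull becomes a pull inside `u`,
-- now in front, and a `right` pull becomes a `left` one in the last tree. The bound serves the
-- recursion, as the new pull is not a part of the old one.
pull-to-root : ∀ bound {k s t} → k ≤ bound → Pull k s t →
  ∃ λ i → ∃₂ λ u v → σ^ i s ≡ before u v × σ^ i t ≡ after u v
pull-to-root bound       _        (root {u} {v}) = 0 , u , v , refl , refl
pull-to-root (suc bound) (s≤s le) (left {v = v} p) =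
  let i , a , b , e , e′ = pull-to-root bound le (pull-⊕ˡ (node v leaf) p) in
  i + 1 , a , b , trans (σ^-+ i 1 _) e , trans (σ^-+ i 1 _) e′
pull-to-root (suc bound) (s≤s le) (right {k} {u} p) =
  let i , a , b , e , e′ = pull-to-root bound (subst (_≤ bound) (sym (+-suc _ k)) le) (pull-⊕ʳ u (left p)) in
  i + 1 , a , b , trans (σ^-+ i 1 _) e , trans (σ^-+ i 1 _) e′

-- If neither `u` nor `v` admits a pull, both are stars. A nonempty star `u` begins with a leaf,
-- which can be pulled to the root; an empty one makes the whole forest a star.
star-or-pull : ∀ t → t ≡ star (size t) ⊎ ∃₂ λ k s → Pull k t s
star-or-pull leaf       = inj₁ refl
star-or-pull (node u v) with star-or-pull u | star-or-pull v
... | inj₂ (k , s , p) | _                = inj₂ (_ , _ , left p)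
... | inj₁ _           | inj₂ (k , s , p) = inj₂ (_ , _ , right p)
... | inj₁ eu          | inj₁ ev          = at-root u eu
  where
  at-root : ∀ u → u ≡ star (size u) → node u v ≡ star (size (node u v)) ⊎ ∃₂ λ k s → Pull k (node u v) s
  at-root leaf       _ = inj₁ (cong (node leaf) ev)
  at-root (node a b) e with node-injective e
  ... | refl , _ = inj₂ (_ , _ , root)

-- Counting forests, and the resulting bound

-- Bounding the height of the binary tree allows plain recursion. Forests of other sizes also occur
-- and are skipped by `reach-all`.
treesUpTo : ℕ → List Tree
treesUpTo zero    = [ leaf ]
treesUpTo (suc k) = leaf ∷ cartesianProductWith node (treesUpTo k) (treesUpTo k)

∈-treesUpTo : ∀ k t → size t ≤ k → t ∈ treesUpTo k
∈-treesUpTo zero    leaf       _        = here refl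
∈-treesUpTo (suc k) leaf       _        = here refl
∈-treesUpTo (suc k) (node u v) (s≤s le) = there (∈-cartesianProductWith⁺ node
  (∈-treesUpTo k u (≤-trans (m≤m+n (size u) (size v)) le))
  (∈-treesUpTo k v (≤-trans (m≤n+m (size v) (size u)) le)))

-- As binary trees these are the paths with `suc k` nodes: each of `k` binary choices hangs the
-- remainder on the left or on the right.
caterpillars : ℕ → List Tree
caterpillars zero    = [ node leaf leaf ]
caterpillars (suc k) = map (λ t → node t leaf) (caterpillars k) ++ map (node leaf) (caterpillars k)

caterpillars-size : ∀ k {t} → t ∈ caterpillars k → size t ≡ suc k
caterpillars-size zero    (here refl) = refl
caterpillars-size (suc k) t∈ with ∈-++⁻ (map (λ t → node t leaf) (caterpillars k)) t∈
... | inj₁ t∈ˡ with ∈-map⁻ (λ t → node t leaf) t∈ˡ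
... | s , s∈ , refl = cong suc (trans (+-identityʳ _) (caterpillars-size k s∈))
caterpillars-size (suc k) t∈ | inj₂ t∈ʳ with ∈-map⁻ (node leaf) t∈ʳ
... | s , s∈ , refl = cong suc (caterpillars-size k s∈)

caterpillars-unique : ∀ k → Unique (caterpillars k)
caterpillars-unique zero    = [] ∷ []
caterpillars-unique (suc k) = Unique.++⁺
  (Unique.map⁺ (λ e → proj₁ (node-injective e)) (caterpillars-unique k))
  (Unique.map⁺ (λ e → proj₂ (node-injective e)) (caterpillars-unique k))
  λ (x∈ , y∈) → disjoint x∈ y∈
  where
  disjoint : ∀ {t} → t ∈ map (λ t → node t leaf) (caterpillars k) → t ∈ map (node leaf) (caterpillars k) → ⊥
  disjoint x∈ y∈ with ∈-map⁻ (λ t → node t leaf) x∈ | ∈-map⁻ (node leaf) y∈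
  ... | _ , s∈ , refl | _ , _ , e = 0≢1+n (trans (cong size (sym (proj₁ (node-injective e)))) (caterpillars-size k s∈))

caterpillars-length : ∀ k → length (caterpillars k) ≡ 2 ^ k
caterpillars-length zero    = refl
caterpillars-length (suc k) = trans (length-++ (map (λ t → node t leaf) (caterpillars k)))
  (cong₂ _+_ (trans (length-map _ (caterpillars k)) (caterpillars-length k))
    (trans (length-map (node leaf) (caterpillars k)) (trans (caterpillars-length k) (sym (+-identityʳ _)))))

-- The 2 in `2 + k` stems from the factor 1/4 and settles q = 0 and q = 1. For q = 3 + p the
-- exponent m is at least 10 + 4p = (3 + p) + (7 + 3p), where the first summand is q and the power
-- of 2 with the second exceeds 2(m + 1). For q = 2 the same estimate would read 20 ≤ 16, hence the
-- four explicit comparisons.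
enough-choices : ∀ q r m k → suc (suc m) ≡ r + q * 4 → r < 4 → 2 ^ m ≤ suc k * (suc m + suc m) → 2 ^ q ≤ 2 + k
enough-choices 0 r m k e r<4 le = s≤s z≤n
enough-choices 1 r m k e r<4 le = s≤s (s≤s z≤n)
enough-choices 2 r m k e r<4 le = +-monoʳ-≤ 2 (≰⇒> λ k≤1 → tooFew r r<4
    (suc-injective (suc-injective (trans e (+-comm r 8)))) (≤-trans le (*-monoˡ-≤ (suc m + suc m) (s≤s k≤1))))
  where
  tooFew : ∀ r {m} → r < 4 → m ≡ 6 + r → ¬ 2 ^ m ≤ 2 * (suc m + suc m)
  tooFew 0 _ refl = from-no (64 ≤? 28)
  tooFew 1 _ refl = from-no (128 ≤? 32)
  tooFew 2 _ refl = from-no (256 ≤? 36)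
  tooFew 3 _ refl = from-no (512 ≤? 40)
  tooFew (suc (suc (suc (suc _)))) (s≤s (s≤s (s≤s (s≤s ())))) _
enough-choices (suc (suc (suc p))) r m k e r<4 le = ≮⇒≥ λ k+2<Q → <-irrefl refl (begin-strict
    2 ^ m                                ≤⟨ le ⟩
    suc k * (suc m + suc m)              <⟨ *-monoˡ-< (suc m + suc m) (≤-trans (n<1+n (suc k)) (<⇒≤ k+2<Q)) ⟩
    Q * (suc m + suc m)                  ≤⟨ *-monoʳ-≤ Q (+-mono-≤ m+1≤ m+1≤) ⟩
    Q * ((14 + p * 4) + (14 + p * 4))    ≤⟨ *-monoʳ-≤ Q (linear≤exponential p) ⟩
    Q * 2 ^ (7 + 3 * p)                  ≡⟨ sym (^-distribˡ-+-* 2 (3 + p) (7 + 3 * p)) ⟩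
    2 ^ (3 + p + (7 + 3 * p))            ≤⟨ ^-monoʳ-≤ 2 (subst (_≤ m) (exponent p) (≤-trans (m≤n+m (10 + p * 4) r) (≤-reflexive (sym m≡)))) ⟩
    2 ^ m                                ∎)
  where
  open ≤-Reasoning
  Q = 2 ^ (3 + p)
  exponent : ∀ p → 10 + p * 4 ≡ 3 + p + (7 + 3 * p)
  exponent = solve-∀
  regroup : ∀ r p → r + (3 + p) * 4 ≡ suc (suc (r + (10 + p * 4)))
  regroup = solve-∀
  m≡ : m ≡ r + (10 + p * 4)
  m≡ = suc-injective (suc-injective (trans e (regroup r p)))
  m+1≤ : suc m ≤ 14 + p * 4
  m+1≤ = subst (λ m → suc m ≤ 14 + p * 4) (sym m≡) (+-monoˡ-≤ (10 + p * 4) r<4)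
  linear≤exponential : ∀ p → (14 + p * 4) + (14 + p * 4) ≤ 2 ^ (7 + 3 * p)
  linear≤exponential zero    = from-yes (28 ≤? 128)
  linear≤exponential (suc p) = begin
    (14 + suc p * 4) + (14 + suc p * 4)                     ≡⟨ step p ⟩
    8 + ((14 + p * 4) + (14 + p * 4))                       ≤⟨ +-mono-≤ (≤-trans (from-yes (8 ≤? 28)) (28≤ p)) ≤-refl ⟩
    ((14 + p * 4) + (14 + p * 4)) + ((14 + p * 4) + (14 + p * 4)) ≤⟨ +-mono-≤ (linear≤exponential p) (linear≤exponential p) ⟩
    2 ^ (7 + 3 * p) + 2 ^ (7 + 3 * p)                       ≡⟨ cong (2 ^ (7 + 3 * p) +_) (sym (+-identityʳ _)) ⟩
    2 ^ (8 + 3 * p)                                         ≤⟨ ^-monoʳ-≤ 2 (≤-trans (m≤n+m (8 + 3 * p) 2) (≤-reflexive (shift-exponent p))) ⟩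
    2 ^ (7 + 3 * suc p)                                     ∎
    where
    step : ∀ p → (14 + suc p * 4) + (14 + suc p * 4) ≡ 8 + ((14 + p * 4) + (14 + p * 4))
    step = solve-∀
    shift-exponent : ∀ p → 2 + (8 + 3 * p) ≡ 7 + 3 * suc p
    shift-exponent = solve-∀
    28≤ : ∀ p → 28 ≤ (14 + p * 4) + (14 + p * 4)
    28≤ p = +-mono-≤ (m≤m+n 14 (p * 4)) (m≤m+n 14 (p * 4))

-- All plane trees attached: the Hamilton cycles

module Assemble (n : ℕ) (n≥1 : 1 ≤ n) where

  open Vertices n
  open Lists {BitStr n}
  open Walks Adjacent (λ {u} {v} → adjacent-sym u v)
  open Gluing n n≥1
  open Build n n≥1
  open Covering
  open Family
  open import Data.List.Membership.DecPropositional _≟ᵀ_ using (_∈?_)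

  -- The result of a pull has smaller area and is reached first. After moving the root so that the
  -- pull takes place there, the orbit of `t` is attached.
  reach : ∀ bound t → area t ≤ bound → size t ≡ n → ∀ F → ∃ λ G → F ⊆ᵀ G × t ∈ trees G
  reach bound t le st F = decide (t ∈? trees F)
    where
    attached : ∀ G {k s} → F ⊆ᵀ G → Pull k t s → s ∈ trees G → Dec (t ∈ trees G) →
      ∃ λ H → F ⊆ᵀ H × t ∈ trees H
    attached G F⊆G p s∈ (yes t∈) = G , F⊆G , t∈
    attached G {k} {s} F⊆G p s∈ (no t∉) =
      let i , u , v , e , e′ = pull-to-root k ≤-refl p
          m , back = σ^-return i t
          return-to : ∀ H → before u v ∈ trees H → t ∈ trees H
          return-to H b∈ = subst (_∈ trees H) (trans (cong (σ^ m) (sym e)) back) (σ^-closed (closed H) m b∈)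
          H , G⊆H , b∈ = attach G u v (trans (cong size (sym e)) (trans (size-σ^ i t) st))
            (λ b∈ → t∉ (return-to G b∈)) (subst (_∈ trees G) e′ (σ^-closed (closed G) i s∈))
      in H , (λ x∈ → G⊆H (F⊆G x∈)) , return-to H b∈
    via : ∀ bound → area t ≤ bound → t ≡ star (size t) ⊎ (∃₂ λ k s → Pull k t s) → ∃ λ G → F ⊆ᵀ G × t ∈ trees G
    via bound le (inj₁ e) = F , (λ x → x) , subst (_∈ trees F) (sym (trans e (cong star st))) (has-star F)
    via bound le (inj₂ (k , s , p)) = descend bound (subst (_≤ bound) (pull-area p) le)
      where
      descend : ∀ bound → suc (area s) ≤ bound → ∃ λ G → F ⊆ᵀ G × t ∈ trees G
      descend (suc bound) (s≤s le) =
        let G , F⊆G , s∈ = reach bound s le (trans (sym (pull-size p)) st) F in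
        -- Membership is tested again, since the orbits attached on the way to `s` may already
        -- contain `t`.
        attached G F⊆G p s∈ (t ∈? trees G)
    decide : Dec (t ∈ trees F) → ∃ λ G → F ⊆ᵀ G × t ∈ trees G
    decide (yes t∈) = F , (λ x → x) , t∈
    decide (no _)   = via bound le (star-or-pull t)

  reach-all : ∀ ts F → ∃ λ G → F ⊆ᵀ G × (∀ {t} → t ∈ ts → size t ≡ n → t ∈ trees G)
  reach-all []       F = F , (λ x → x) , λ ()
  reach-all (t ∷ ts) F =
    let G , F⊆G , all = reach-all ts F
        H , G⊆H , t∈  = one G (size t ≟ n)
    in H , (λ x∈ → G⊆H (F⊆G x∈)) , λ { (here refl) st → t∈ st ; (there s∈) st → G⊆H (all s∈ st) }
    where
    one : ∀ G → Dec (size t ≡ n) → ∃ λ H → G ⊆ᵀ H × (size t ≡ n → t ∈ trees H)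
    one G (yes st) = let H , G⊆H , t∈ = reach (area t) t ≤-refl st G in H , G⊆H , λ _ → t∈
    one G (no ≢n)  = G , (λ x → x) , λ st → ⊥-elim (≢n st)

  full : ∀ m → n ≡ suc m → ∃ λ F → ∀ t → size t ≡ n → t ∈ trees F
  full m e = let F , _ , all = reach-all (treesUpTo n) (initial m e) in
    F , λ t st → all (∈-treesUpTo n t (≤-reflexive st)) st

  link-edge : ∀ {S u v} (c : Covering S) → Link (vertices c) u v → EdgeOf (vertices c) u v
  link-edge c (inj₁ i) = inj₁ (next-cyclic i)
  link-edge c (inj₂ i) = inj₂ (next-cyclic i)

  distinct⇒different : ∀ {S} {c d : Covering S} → Distinct c d → DifferentCycles (vertices c) (vertices d)
  distinct⇒different {c = c} {d} (inj₁ (_ , _ , _ , _ , _ , _ , _ , l , l′ , l″ , ne , ne′ , ne″)) same =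
    three-neighbours (unique c) (link-edge c l) (link-edge c l′)
      (Equivalence.from (same _ _) (link-edge d l″)) ne ne′ ne″
  distinct⇒different {c = c} {d} (inj₂ (_ , _ , _ , _ , _ , _ , _ , l , l′ , l″ , ne , ne′ , ne″)) same =
    three-neighbours (unique d) (link-edge d l) (link-edge d l′)
      (Equivalence.to (same _ _) (link-edge c l″)) ne ne′ ne″

  module _ (F : Family) (everything : ∀ t → size t ≡ n → t ∈ trees F) where

    hamiltonian : (c : Covering (trees F)) → IsHamiltonCycle n (vertices c)
    hamiltonian c = record
      { long     = unique-length three three⊆
      ; distinct = unique c
      ; inGraph  = All.tabulate λ v∈ → let b , t , j , t∈ , e = sound c v∈ in
                     subst (IsMiddleVertex n) (sym e) (vertex-middle b t j (sized F t∈))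
      ; spanning = λ v mid → let b , t , j , st , e = vertex-surjective v mid in
                     subst (_∈ vertices c) (sym e) (complete c b j (everything t st))
      ; adjacent = chain-cyclic (chain c)
      }
      where
      s : Tree
      s = star n
      ss : size s ≡ n
      ss = size-star n
      three : Unique (vertex false s 0 ∷ vertex false s 1 ∷ vertex true s 0 ∷ [])
      three =
        ((λ e → mod-small (s≤s z≤n) (+-monoˡ-≤ 1 (≤-trans n≥1 (m≤m+n n (1 * n))))
                  (mod-sym (proj₂ (vertex-injective false s s 0 1 ss ss e)))) ∷
         lower≢upper s s 0 0 ss ss ∷ []) ∷
        (lower≢upper s s 1 0 ss ss ∷ []) ∷ [] ∷ []
      three⊆ : ∀ {x} → x ∈ vertex false s 0 ∷ vertex false s 1 ∷ vertex true s 0 ∷ [] → x ∈ vertices c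
      three⊆ (here refl)                 = complete c false 0 (has-star F)
      three⊆ (there (here refl))         = complete c false 1 (has-star F)
      three⊆ (there (there (here refl))) = complete c true 0 (has-star F)

    -- The length of `trees F` counts repeated forests as well, which is harmless for an upper bound
    -- on the number of caterpillars.
    many-trees : ∀ m → n ≡ suc m → 2 ^ m ≤ suc (choices F) * (suc m + suc m)
    many-trees m e = subst₂ _≤_ (caterpillars-length m)
      (trans (length-trees F) (cong (λ n → suc (choices F) * (n + n)) e))
      (Lists.unique-length (caterpillars-unique m)
        λ {t} t∈ → everything t (trans (caterpillars-size m t∈) (sym e)))

    cycles : List (List (BitStr n))
    cycles = map vertices (coverings F)

    hamiltonian-cycles : All (IsHamiltonCycle n) cycles
    hamiltonian-cycles = All.map⁺ (All.universal hamiltonian (coverings F))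

    different-cycles : AllPairs DifferentCycles cycles
    different-cycles = AllPairs.map⁺ (AllPairs.map (λ {c} {d} → distinct⇒different {c = c} {d}) (distinct F))

    enough-cycles : ∀ m → n ≡ suc m → 2 ^ (2 ^ ((n + 1) / 4)) ≤ 4 * length cycles
    enough-cycles m e = begin
      2 ^ (2 ^ ((n + 1) / 4))      ≤⟨ ^-monoʳ-≤ 2 (enough-choices ((n + 1) / 4) ((n + 1) % 4) m (choices F)
                                        (trans (trans (cong suc (sym e)) (+-comm 1 n)) (m≡m%n+[m/n]*n (n + 1) 4))
                                        (m%n<n (n + 1) 4) (many-trees m e)) ⟩
      2 ^ (2 + choices F)          ≡⟨ quadruple (2 ^ choices F) ⟩
      4 * 2 ^ choices F            ≡⟨ cong (4 *_) (sym (trans (length-map vertices (coverings F)) (count F))) ⟩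
      4 * length cycles            ∎
      where
      open ≤-Reasoning
      quadruple : ∀ x → 2 * (2 * x) ≡ 4 * x
      quadruple = solve-∀

theorem2 : (n : ℕ) → 1 ≤ n →
    Σ (List (List (BitStr n))) (λ cs →
    All (IsHamiltonCycle n) cs × AllPairs DifferentCycles cs ×
    2 ^ (2 ^ ((n + 1) / 4)) ≤ 4 * length cs)
theorem2 n@(suc m) n≥1 =
  let F , everything = full m refl in
  cycles F everything , hamiltonian-cycles F everything , different-cycles F everything , enough-cycles F everything m refl
  where open Assemble n n≥1
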